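{- Let $s,t\ge1$ be coprime integers, let $t'=\lfloor t/2\rfloor$, and let $\lambda$ be a self-conjugate $s$-core with $t$-core $\lambda^t$. Write $z_{t,i}=z_{t,i}(\lambda^t)$ and $u_i=u_i(\lambda^t)$. (1) If $t$ is odd, then $$|\mathrm{Stab}_{H_{s,t}}(\lambda)|=2^{\lfloor z_{t,0}/2\rfloor}\,\lfloor z_{t,0}/2\rfloor!\,\prod_{i=1}^{t'}z_{t,i}!=2^{u_0}\prod_{i=0}^{t'}u_i!.$$ (2) If $t$ is even (so $s$ is odd), then $$|\mathrm{Stab}_{H_{s,t}}(\lambda)|=2^{\lfloor z_{t,0}/2\rfloor}\,\lfloor z_{t,0}/2\rfloor!\;2^{\lfloor z_{t,t'}/2\rfloor}\,\lfloor z_{t,t'}/2\rfloor!\,\prod_{i=1}^{t'-1}z_{t,i}!=2^{u_0+u_{t'}}\prod_{i=0}^{t'}u_i!.$$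
   Context: A partition is an infinite weakly decreasing sequence $\lambda=(\lambda_1,\lambda_2,\ldots)$ of nonnegative integers with finite sum. Its Young diagram is $[\lambda]=\{(r,c)\in\mathbb{Z}_{>0}^2 : c\le\lambda_r\}$, its conjugate $\overline{\lambda}$ is given by $\overline{\lambda}_r=\#\{c\in\mathbb{Z}_{>0}: r\le\lambda_c\}$; $\lambda$ is self-conjugate if $\lambda=\overline\lambda$. The rim hook of $(r,c)\in[\lambda]$ is $\{(i,j)\in[\lambda]: i\ge r,\ j\ge c,\ (i+1,j+1)\notin[\lambda]\}$, of length $1+(\lambda_r-r)+(\overline{\lambda}_c-c)$; removing it leaves the Young diagram of a smaller partition. A partition is an $s$-core if it has no rim hook of length $s$; $\mathcal{C}_s$ (resp. $\mathcal{D}_s$) is the set of $s$-cores (resp. self-conjugate $s$-cores). For any partition $\lambda$ and $t\ge1$, repeatedly removing rim hooks of length $t$ until none remains yields a $t$-core, independent of the choices made, denoted $\lambda^t$; if $\lambda\in\mathcal{D}_s$ then $\lambda^t\in\mathcal{D}_s\cap\mathcal{D}_t$. The beta-set of $\lambda$ is $B^\lambda=\{\lambda_i-i: i\ge1\}\subset\mathbb{Z}$. For an $s$-core $\lambda$ the $s$-set is $\mathcal{S}_s(\lambda)=(B^\lambda+s)\setminus B^\lambda$; $\lambda\mapsto\mathcal{S}_s(\lambda)$ is a bijection from $\mathcal{C}_s$ to the collection of all sets of $s$ integers pairwise incongruent modulo $s$ with sum $\binom s2$, and an $s$-core $\lambda$ is self-conjugate iff $\mathcal{S}_s(\lambda)=s-1-\mathcal{S}_s(\lambda)$.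 Coordinates of a $t$-core $\mu$: $a_{t,i}(\mu)=t+\max[B^\mu\cap(i+t\mathbb{Z})]$ for $i\in\mathbb{Z}/t\mathbb{Z}$; with $k=\frac12(s+1)(t-1)\in\mathbb{Z}$, $z_{t,j}(\mu)=\frac1t\bigl(a_{t,sj+k}(\mu)-[a_{t,s(j+1)+k}(\mu)-s]\bigr)$ for $j\in\mathbb{Z}/t\mathbb{Z}$. For $\mu\in\mathcal{D}_s\cap\mathcal{D}_t$ the $z_{t,j}(\mu)$ are nonnegative integers with $z_{t,j}=z_{t,-j}$ (and $z_{t,t'}$ even if $t$ is even), and the $u$-coordinates are $u_0=\lfloor z_{t,0}/2\rfloor$ together with $u_i=z_{t,i}$ for $1\le i\le t'$ if $t$ is odd; and $u_i=z_{t,i}$ for $1\le i\le t'-1$, $u_{t'}=z_{t,t'}/2$ if $t$ is even. $H_{s,t}$ is the group (under composition) of permutations $f:\mathbb{Z}\to\mathbb{Z}$ such that $f(m+s)=f(m)+s$ for all $m$; $\sum_{i=0}^{s-1}f(i)=\binom{s}{2}$; $f(m)\equiv m\pmod t$ for all $m$; and $f(-1-m)=-1-f(m)$ for all $m$. It acts on $\mathcal{D}_s$ by letting $f\lambda$ be the self-conjugate $s$-core with $\mathcal{S}_s(f\lambda)=f(\mathcal{S}_s(\lambda))$. -}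

module Defs where

open import Data.Fin using (Fin)
open import Data.Integer using (ℤ; +_; -_; _+_; _-_; _*_; _≤_; 0ℤ; 1ℤ; -1ℤ; ∣_∣; +≤+; _%ℕ_; _/ℕ_)
import Data.Integer.DivMod as ℤ
import Data.Integer.Properties as ℤ
open import Data.Integer.Divisibility.Signed using (_∣_; divides; quotient; _∣?_; ∣m∣n⇒∣m-n)
open import Data.Integer.Tactic.RingSolver using (solve-∀)
open import Data.List using (length; filter; map; foldr; upTo)
open import Data.Nat as ℕ using (ℕ; zero; suc; z≤n; s≤s; NonZero)
open import Data.Nat.Combinatorics using (_C_)
import Data.Nat.Divisibility as ℕ
open import Data.Nat.ListAction using (product)
import Data.Nat.Properties as ℕ
open import Data.Product using (Σ; ∃; ∃₂; _×_; _,_; proj₁; proj₂)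
open import Function using (_↔_; _⇔_; Inverse)
open import Level using (0ℓ)
open import Relation.Binary using (Setoid)
open import Relation.Binary.Construct.Closure.ReflexiveTransitive using (Star)
open import Relation.Binary.PropositionalEquality using (_≡_; _≢_; refl; sym; trans; cong; subst; setoid; module ≡-Reasoning)
open import Relation.Nullary using (¬_; yes; no; contradiction)
open import Relation.Unary using (Pred; Decidable; _∈_; _≐_)

-- Rows and columns are numbered from zero: `part i` is the (i+1)-st part.
-- For natural numbers, having finite sum is the same as vanishing from
-- some index on.
record Partition : Set where
  field
    part       : ℕ → ℕ
    decreasing : ∀ {i j} → i ℕ.≤ j → part j ℕ.≤ part i
    vanishes   : ∃ λ N → ∀ {i} → N ℕ.≤ i → part i ≡ 0

open Partition public

Diagram : Partition → ℕ → ℕ → Set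
Diagram p r c = c ℕ.< part p r

-- All c with r < part c lie below the index from which the parts vanish, so
-- this counts every such c.
conjugate : Partition → ℕ → ℕ
conjugate p r = length (filter (λ c → r ℕ.<? part p c) (upTo (proj₁ (vanishes p))))

SelfConjugate : Partition → Set
SelfConjugate p = ∀ r → part p r ≡ conjugate p r

RimHook : Partition → (r c : ℕ) → ℕ → ℕ → Set
RimHook p r c i j = Diagram p i j × r ℕ.≤ i × c ℕ.≤ j × ¬ Diagram p (suc i) (suc j)

hookLength : Partition → ℕ → ℕ → ℤ
hookLength p r c = 1ℤ + (+ part p r - + suc r) + (+ conjugate p c - + suc c)

RemovesHook : ℕ → Partition → Partition → Set
RemovesHook t p q = ∃₂ λ r c → Diagram p r c × hookLength p r c ≡ + t ×
  (∀ i j → Diagram q i j ⇔ (Diagram p i j × ¬ RimHook p r c i j))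

IsCore : ℕ → Partition → Set
IsCore s p = ∀ r c → Diagram p r c → hookLength p r c ≢ + s

SelfConjugateCore : ℕ → Partition → Set
SelfConjugateCore s p = IsCore s p × SelfConjugate p

-- `IsCoreOf t p q` says that q is the t-core of p: it is reached from p by
-- successive removals of rim hooks of length t, and none remains.
IsCoreOf : ℕ → Partition → Partition → Set
IsCoreOf t p q = Star (RemovesHook t) p q × IsCore t q

β : Partition → ℕ → ℤ
β p i = + part p i - + suc i

BetaSet : Partition → Pred ℤ 0ℓ
BetaSet p x = ∃ λ i → x ≡ β p i

SSet : ℕ → Partition → Pred ℤ 0ℓ
SSet s p x = (x - + s) ∈ BetaSet p × ¬ (x ∈ BetaSet p)

Image : (ℤ → ℤ) → Pred ℤ 0ℓ → Pred ℤ 0ℓ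
Image f A y = ∃ λ x → x ∈ A × f x ≡ y

Class : ℕ → ℤ → Pred ℤ 0ℓ
Class t i x = + t ∣ (x - i)

IsMaximum : Pred ℤ 0ℓ → ℤ → Set
IsMaximum A m = m ∈ A × (∀ {x} → x ∈ A → x ≤ m)

BetaClass : ℕ → Partition → ℤ → Pred ℤ 0ℓ
BetaClass t p i x = x ∈ BetaSet p × x ∈ Class t i

private
  β-decreasing : ∀ p {m n} → m ℕ.≤ n → β p n ≤ β p m
  β-decreasing p m≤n = ℤ.+-mono-≤ (+≤+ (decreasing p m≤n))
                                   (ℤ.neg-mono-≤ (+≤+ (s≤s m≤n)))

  least : ∀ {P : Pred ℕ 0ℓ} → Decidable P → ∀ n → P n → ∃ λ m → P m × (∀ {k} → P k → m ℕ.≤ k)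
  least P? n pn with P? 0
  ... | yes p0 = 0 , p0 , λ _ → z≤n
  least P? zero    pn | no ¬p0 = contradiction pn ¬p0
  least {P} P? (suc n) pn | no ¬p0 with least (λ k → P? (suc k)) n pn
  ... | m , pm , min = suc m , pm , min′
    where
    min′ : ∀ {k} → P k → suc m ℕ.≤ k
    min′ {zero}  p0 = contradiction p0 ¬p0
    min′ {suc k} pk = s≤s (min pk)

  class-inhabited : ∀ t .{{_ : NonZero t}} p i → ∃ λ n → β p n ∈ Class t i
  class-inhabited t p i = N ℕ.+ r , divides q eq
    where
    open ≡-Reasoning
    N = proj₁ (vanishes p)
    w = - i - + suc N
    r = w %ℕ t
    q = w /ℕ t
    cancel : ∀ r q t → (r + q * t) - r ≡ q * t
    cancel = solve-∀
    flip : ∀ i N r → 0ℤ - (1ℤ + (N + r)) - i ≡ (- i - (1ℤ + N)) - r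
    flip = solve-∀
    eq : β p (N ℕ.+ r) - i ≡ q * + t
    eq = begin
      + part p (N ℕ.+ r) - + suc (N ℕ.+ r) - i
        ≡⟨ cong (λ v → + v - + suc (N ℕ.+ r) - i) (proj₂ (vanishes p) (ℕ.m≤m+n N r)) ⟩
      0ℤ - (1ℤ + (+ N + + r)) - i  ≡⟨ flip i (+ N) (+ r) ⟩
      w - + r                      ≡⟨ cong (_- + r) (ℤ.a≡a%ℕn+[a/ℕn]*n w t) ⟩
      (+ r + q * + t) - + r        ≡⟨ cancel (+ r) q (+ t) ⟩
      q * + t                      ∎

abstract
  maximum : ∀ t .{{_ : NonZero t}} p i → ∃ (IsMaximum (BetaClass t p i))
  maximum t p i with class-inhabited t p i
  ... | n , n∈ with least (λ k → + t ∣? (β p k - i)) n n∈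
  ... | m , m∈ , min = β p m , ((m , refl) , m∈) , bound
    where
    bound : ∀ {x} → x ∈ BetaClass t p i → x ≤ β p m
    bound ((k , refl) , k∈) = β-decreasing p (min k∈)

a : ∀ t .{{_ : NonZero t}} → Partition → ℤ → ℤ
a t p i = + t + proj₁ (maximum t p i)

-- The halving is exact when s and t are coprime, as then s or t is odd.
shift : ℕ → ℕ → ℤ
shift s t = + ((suc s ℕ.* (t ℕ.∸ 1)) ℕ./ 2)

zNumerator : ∀ s t .{{_ : NonZero t}} → Partition → ℤ → ℤ
zNumerator s t p j =
  a t p (+ s * j + shift s t) - (a t p (+ s * (j + 1ℤ) + shift s t) - + s)

maximum-congruent : ∀ t .{{_ : NonZero t}} p i → + t ∣ (proj₁ (maximum t p i) - i)
maximum-congruent t p i = proj₂ (proj₁ (proj₂ (maximum t p i)))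

abstract
  numerator-divisible : ∀ s t .{{_ : NonZero t}} p j → + t ∣ zNumerator s t p j
  numerator-divisible s t p j =
    subst (+ t ∣_)
          (rearrange (+ t) (+ s) j (shift s t) (proj₁ (maximum t p i)) (proj₁ (maximum t p i′)))
          (∣m∣n⇒∣m-n (maximum-congruent t p i) (maximum-congruent t p i′))
    where
    i i′ : ℤ
    i  = + s * j + shift s t
    i′ = + s * (j + 1ℤ) + shift s t
    rearrange : ∀ t s j k m m′ →
      (m - (s * j + k)) - (m′ - (s * (j + 1ℤ) + k)) ≡ (t + m) - ((t + m′) - s)
    rearrange = solve-∀

zℤ : ∀ s t .{{_ : NonZero t}} → Partition → ℤ → ℤ
zℤ s t p j = quotient (numerator-divisible s t p j)

-- zℤ is nonnegative on partitions that are both s-cores and t-cores, the only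
-- ones for which z is meant; there the absolute value changes nothing.
z : ∀ s t .{{_ : NonZero t}} → Partition → ℕ → ℕ
z s t p i = ∣ zℤ s t p (+ i) ∣

-- The values for i > ⌊t/2⌋ are not meaningful.
u : ∀ s t .{{_ : NonZero t}} → Partition → ℕ → ℕ
u s t p zero = z s t p 0 ℕ./ 2
u s t p i@(suc _) with 2 ℕ.∣? t | i ℕ.≟ t ℕ./ 2
... | yes _ | yes _ = z s t p i ℕ./ 2
... | _     | _     = z s t p i

record H (s t : ℕ) : Set where
  field
    permutation   : ℤ ↔ ℤ
  apply : ℤ → ℤ
  apply = Inverse.to permutation
  field
    periodic      : ∀ m → apply (m + + s) ≡ apply m + + s
    balanced      : foldr _+_ 0ℤ (map (λ i → apply (+ i)) (upTo s)) ≡ + (s C 2)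
    congruent     : ∀ m → + t ∣ (apply m - m)
    antisymmetric : ∀ m → apply (-1ℤ - m) ≡ -1ℤ - apply m

-- `Acts f p q` says that q is the partition f p, the self-conjugate s-core
-- whose s-set is the image under f of that of p.
Acts : ∀ {s t} → H s t → Partition → Partition → Set
Acts {s} f p q = SelfConjugateCore s q × SSet s q ≐ Image (H.apply f) (SSet s p)

Stabilizer : (s t : ℕ) → Partition → Setoid 0ℓ 0ℓ
Stabilizer s t p = record
  { Carrier       = Σ (H s t) λ f → Acts f p p
  ; _≈_           = λ f g → ∀ m → H.apply (proj₁ f) m ≡ H.apply (proj₁ g) m
  ; isEquivalence = record
    { refl  = λ _ → refl
    ; sym   = λ e m → sym (e m)
    ; trans = λ e e′ m → trans (e m) (e′ m)
    }
  }

HasCardinality : Setoid 0ℓ 0ℓ → ℕ → Set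
HasCardinality S n = Inverse (setoid (Fin n)) S

-- The product of the f i with m ≤ i ≤ n.
∏[_⋯_] : ℕ → ℕ → (ℕ → ℕ) → ℕ
∏[ m ⋯ n ] f = product (map (λ i → f (m ℕ.+ i)) (upTo (suc n ℕ.∸ m)))

module Submission where

-- An element of the stabilizer of λ is determined by its restriction to the
-- s-set S of λ, which contains exactly one integer from every class modulo s.
-- This identifies the stabilizer with the permutations of S that preserve
-- classes modulo t and commute with the involution x ↦ s - 1 - x. They are
-- counted by an orbit-stabilizer chain: the images available for an element x
-- are the elements of its class, and composing with (x y)(x′ y′), where x′ and
-- y′ are the mirror images, reduces to the permutations that fix x and x′. So a
-- class that is not its own mirror image contributes, together with its mirror
-- image, a symmetric group, and a self-mirror class a hyperoctahedral group on
-- its non-central elements. It remains to see that S has z_{t,j}(λᵗ) elements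
-- congruent to s(j + 1) + k. As S = (B + s) ∖ B, this number is a difference of
-- numbers of beads in two classes modulo t; removing rim t-hooks does not change
-- the latter, and for a t-core they are read off the coordinates a_{t,i}.

open import Defs
open import Data.Fin using (Fin; zero; suc; combine; remQuot)
open import Data.Fin.Properties using (remQuot-combine; combine-remQuot)
open import Data.Integer using (ℤ)
import Data.Integer.DivMod as ℤ
import Data.Integer.Properties as ℤ
open import Data.List using (List; []; _∷_; _++_; foldr; length; filter; map; upTo; applyUpTo; lookup)
open import Data.List.Membership.Propositional using (find) renaming (_∈_ to _∈ˡ_)
open import Data.List.Membership.Propositional.Properties using (∈-filter⁺; ∈-filter⁻; ∈-lookup; ∈-upTo⁺; ∈-upTo⁻; ∈-applyUpTo⁺; ∈-applyUpTo⁻; ∈-map⁺; ∈-map⁻; ∈-++⁺ˡ; ∈-++⁺ʳ; ∈-++⁻)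
open import Data.List.Membership.Propositional.Properties.WithK using (unique∧set⇒bag; unique⇒irrelevant)
open import Data.List.Properties using (map-upTo; length-upTo; length-map; length-applyUpTo; length-++; filter-++; filter-≐; filter-notAll)
open import Data.List.Relation.Binary.BagAndSetEquality using (∼bag⇒↭)
open import Data.List.Relation.Binary.Permutation.Propositional.Properties using (↭-length)
open import Data.List.Relation.Unary.All as All using (All; []; _∷_)
open import Data.List.Relation.Unary.AllPairs using ([]; _∷_)
open import Data.List.Relation.Unary.Any as Any using (here; there; index)
open import Data.List.Relation.Unary.Any.Properties using (lookup-index)
open import Data.List.Relation.Unary.Unique.Propositional using (Unique)
import Data.List.Relation.Unary.Unique.Propositional.Properties as Unique
open import Data.Nat as ℕ using (ℕ; zero; suc; z≤n; s≤s; NonZero)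
open import Data.Nat.Combinatorics using (_C_; nC1≡n; nCk+nC[k+1]≡[n+1]C[k+1])
open import Data.Nat.Coprimality using (Coprime; coprime-Bézout)
import Data.Nat.Divisibility as ℕ
import Data.Nat.DivMod as ℕ
open import Data.Nat.GCD using (module Bézout)
open import Data.Nat.ListAction using (product)
import Data.Nat.Properties as ℕ
open import Data.Product using (∃; _×_; _,_; proj₁; proj₂)
open import Data.Sum using (_⊎_; inj₁; inj₂)
open import Function using (_∘_; id; mk⇔; mk↔ₛ′; Inverse; Equivalence)
import Function.Construct.Composition as Composition
open import Level using (0ℓ)
open import Relation.Binary using (Setoid; DecidableEquality; tri<; tri≈; tri>)
open import Relation.Binary.Construct.Closure.ReflexiveTransitive using (Star; ε; _◅_)
open import Relation.Binary.PropositionalEquality using (_≡_; _≢_; refl; sym; trans; cong; cong₂; subst; subst₂; module ≡-Reasoning)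
open import Relation.Nullary using (¬_; yes; no; contradiction)
open import Relation.Nullary.Decidable using (¬?; _×-dec_; _⊎-dec_)
open import Relation.Unary using (Pred; Decidable)

-- Permutations commuting with an involution and preserving labels

-- The rounded halves come from the central element. The mirror has at most one fixed point, and a
-- permutation commuting with the mirror cannot move it, whereas `(x y)(x′ y′)` fails to be a
-- permutation if exactly one of `x` and `y` is self-mirror. The recursion therefore runs on the
-- movable elements only, where every self-mirror class has even size; putting the central element
-- back does not change the rounded half.
--
-- The constant k makes the labels symmetric: as 2k = (s + 1)(t - 1), the mirror takes the class of
-- s(j + 1) + k to that of s(-j + 1) + k. On the labels j it acts as negation modulo t, which fixes
-- only 0 and, for even t, t/2; the labels from 0 to ⌊t/2⌋ represent all mirror pairs.
--
-- A class contains infinitely many beads, so counts are truncated to the indices below some N from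
-- which the parts vanish, that is, to the beads that are at least -N. Cutting B + s and B at the
-- same value -N gives windows of N + s and N indices. Choosing N congruent to -c modulo t makes the
-- class of c in a t-core an arithmetic progression that starts exactly at the cut.

module _ where

  open import Data.List.Membership.Propositional using (_∈_; _∉_)
  open import Data.Nat using (_+_; _*_; _^_; _/_; _!; _≤_; _<_; _≟_)
  open import Data.Nat.Divisibility using (_∣_; divides)
  open import Data.Nat.Tactic.RingSolver using (solve-∀)

  -- Lists, products and cardinalities

  length-unique-set : ∀ {A : Set} {xs ys : List A} → Unique xs → Unique ys →
                      (∀ {x} → x ∈ xs → x ∈ ys) → (∀ {x} → x ∈ ys → x ∈ xs) →
                      length xs ≡ length ys
  length-unique-set u v f g = ↭-length (∼bag⇒↭ (unique∧set⇒bag u v (mk⇔ f g)))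

  -- Membership in a list without repetitions is proof-irrelevant. Hence the position of an image in
  -- its orbit depends on the image alone, and pointwise equal permutations receive the same code.
  index-unique : ∀ {A : Set} {xs : List A} → Unique xs → ∀ {x y} (x∈ : x ∈ xs) (y∈ : y ∈ xs) →
                 x ≡ y → index x∈ ≡ index y∈
  index-unique u x∈ y∈ refl = cong index (unique⇒irrelevant u x∈ y∈)

  index-∈-lookup : ∀ {A : Set} (xs : List A) i → index (∈-lookup {xs = xs} i) ≡ i
  index-∈-lookup (x ∷ xs) zero    = refl
  index-∈-lookup (x ∷ xs) (suc i) = cong suc (index-∈-lookup xs i)

  product-applyUpTo-cong : ∀ {f g : ℕ → ℕ} n → (∀ {i} → i < n → f i ≡ g i) →
                           product (applyUpTo f n) ≡ product (applyUpTo g n)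
  product-applyUpTo-cong zero    f≗g = refl
  product-applyUpTo-cong (suc n) f≗g =
    cong₂ _*_ (f≗g (s≤s z≤n)) (product-applyUpTo-cong n (f≗g ∘ s≤s))

  product-applyUpTo-scale : ∀ {f g : ℕ → ℕ} k {j n} → j < n → f j ≡ k * g j →
                            (∀ {i} → i < n → i ≢ j → f i ≡ g i) →
                            product (applyUpTo f n) ≡ k * product (applyUpTo g n)
  product-applyUpTo-scale {f} {g} k {zero} {suc n} _ eq f≗g = begin
    f 0 * product (applyUpTo (f ∘ suc) n)
      ≡⟨ cong₂ _*_ eq (product-applyUpTo-cong n (λ i<n → f≗g (s≤s i<n) (λ ()))) ⟩
    k * g 0 * product (applyUpTo (g ∘ suc) n)  ≡⟨ ℕ.*-assoc k _ _ ⟩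
    k * (g 0 * product (applyUpTo (g ∘ suc) n)) ∎
    where open ≡-Reasoning
  product-applyUpTo-scale {f} {g} k {suc j} {suc n} (s≤s j<n) eq f≗g = begin
    f 0 * product (applyUpTo (f ∘ suc) n)
      ≡⟨ cong₂ _*_ (f≗g (s≤s z≤n) (λ ()))
                   (product-applyUpTo-scale k j<n eq (λ i<n i≢j → f≗g (s≤s i<n) (i≢j ∘ ℕ.suc-injective))) ⟩
    g 0 * (k * product (applyUpTo (g ∘ suc) n)) ≡⟨ exchange (g 0) k _ ⟩
    k * (g 0 * product (applyUpTo (g ∘ suc) n)) ∎
    where
    open ≡-Reasoning
    exchange : ∀ a b c → a * (b * c) ≡ b * (a * c)
    exchange = solve-∀

  ∏-applyUpTo : ∀ n f → ∏[ 0 ⋯ n ] f ≡ product (applyUpTo f (suc n))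
  ∏-applyUpTo n f = cong product (map-upTo f (suc n))

  module _ {S : Setoid 0ℓ 0ℓ} {n : ℕ} where
    open Setoid S using (Carrier; _≈_)

    hasCardinality : (to : Fin n → Carrier) (from : Carrier → Fin n) →
                     (∀ {x y} → x ≈ y → from x ≡ from y) →
                     (∀ x → to (from x) ≈ x) → (∀ i → from (to i) ≡ i) →
                     HasCardinality S n
    hasCardinality to from from-cong to∘from from∘to = record
      { to        = to
      ; from      = from
      ; to-cong   = λ { refl → Setoid.refl S }
      ; from-cong = from-cong
      ; inverse   = (λ { {x} refl → to∘from x }) ,
                    (λ {i} x≈ → trans (from-cong x≈) (from∘to i))
      }

  [1+n]/2≡n/2 : ∀ {n} → 2 ∣ n → suc n / 2 ≡ n / 2
  [1+n]/2≡n/2 2∣n = ℕ.+-distrib-/-∣ʳ 1 2∣n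

  -- With `c` equal to 2h, this is the recursion |B(h+1)| = 2(h+1)|B(h)| for the orders of the
  -- hyperoctahedral groups; the factor is the size of the orbit of one element.
  hyperoctahedral-step : ∀ {c} → 2 ∣ c →
    2 ^ (suc (suc c) / 2) * (suc (suc c) / 2) ! ≡ suc (suc c) * (2 ^ (c / 2) * (c / 2) !)
  hyperoctahedral-step {c} (divides h refl) = begin
    2 ^ (suc (suc c) / 2) * (suc (suc c) / 2) !  ≡⟨ cong (λ m → 2 ^ m * m !) (ℕ.m*n/n≡m (suc h) 2) ⟩
    2 * 2 ^ h * (suc h * h !)                    ≡⟨ rearrange (2 ^ h) h (h !) ⟩
    suc (suc c) * (2 ^ h * h !)                  ≡⟨ cong (λ m → suc (suc c) * (2 ^ m * m !)) (ℕ.m*n/n≡m h 2) ⟨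
    suc (suc c) * (2 ^ (c / 2) * (c / 2) !)      ∎
    where
    open ≡-Reasoning
    rearrange : ∀ a h b → 2 * a * (suc h * b) ≡ suc (suc (h * 2)) * (a * b)
    rearrange = solve-∀

  module LabelledInvolution
    {A : Set} (_≟ᴬ_ : DecidableEquality A)
    (ι : A → A) (ι-involutive : ∀ x → ι (ι x) ≡ x)
    (ℓ : A → ℕ) (ℓ-ι : ∀ {x y} → ℓ x ≡ ℓ y → ℓ (ι x) ≡ ℓ (ι y))
    where

    ι-injective : ∀ {x y} → ι x ≡ ι y → x ≡ y
    ι-injective {x} {y} eq = trans (sym (ι-involutive x)) (trans (cong ι eq) (ι-involutive y))

    -- The product of the transpositions (x y) and (ι x ι y). If `y` is `ι x`, the tests overlap,
    -- and their order leaves the single transposition (x ι x).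
    swap : A → A → A → A
    swap x y z with z ≟ᴬ x | z ≟ᴬ y | z ≟ᴬ ι x | z ≟ᴬ ι y
    ... | yes _ | _     | _     | _     = y
    ... | no _  | yes _ | _     | _     = x
    ... | no _  | no _  | yes _ | _     = ι y
    ... | no _  | no _  | no _  | yes _ = ι x
    ... | no _  | no _  | no _  | no _  = z

    module _ {x y : A} where

      swap-left : swap x y x ≡ y
      swap-left with x ≟ᴬ x
      ... | yes _  = refl
      ... | no x≢x = contradiction refl x≢x

      swap-right : swap x y y ≡ x
      swap-right with y ≟ᴬ x | y ≟ᴬ y
      ... | yes y≡x | _      = y≡x
      ... | no _    | yes _  = refl
      ... | no _    | no y≢y = contradiction refl y≢y

      -- Were `ι x` equal to `x`, the first test would catch it and return `y`, which differs from
      -- `ι y` unless `y` is self-mirror too. This confines the swaps to elements that the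
      -- involution moves.
      swap-ι-left : ι x ≢ x → swap x y (ι x) ≡ ι y
      swap-ι-left ιx≢x with ι x ≟ᴬ x | ι x ≟ᴬ y | ι x ≟ᴬ ι x
      ... | yes ιx≡x | _        | _        = contradiction ιx≡x ιx≢x
      ... | no _     | yes refl | _        = sym (ι-involutive x)
      ... | no _     | no _     | yes _    = refl
      ... | no _     | no _     | no ιx≢ιx = contradiction refl ιx≢ιx

      swap-ι-right : ι y ≢ y → swap x y (ι y) ≡ ι x
      swap-ι-right ιy≢y with ι y ≟ᴬ x | ι y ≟ᴬ y | ι y ≟ᴬ ι x | ι y ≟ᴬ ι y
      ... | yes refl | _        | _         | _        = sym (ι-involutive y)
      ... | no _     | yes ιy≡y | _         | _        = contradiction ιy≡y ιy≢y
      ... | no _     | no _     | yes ιy≡ιx | _        = ιy≡ιx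
      ... | no _     | no _     | no _      | yes _    = refl
      ... | no _     | no _     | no _      | no ιy≢ιy = contradiction refl ιy≢ιy

      swap-other : ∀ {z} → z ≢ x → z ≢ y → z ≢ ι x → z ≢ ι y → swap x y z ≡ z
      swap-other {z} z≢x z≢y z≢ιx z≢ιy with z ≟ᴬ x | z ≟ᴬ y | z ≟ᴬ ι x | z ≟ᴬ ι y
      ... | yes z≡x | _       | _        | _        = contradiction z≡x z≢x
      ... | no _    | yes z≡y | _        | _        = contradiction z≡y z≢y
      ... | no _    | no _    | yes z≡ιx | _        = contradiction z≡ιx z≢ιx
      ... | no _    | no _    | no _     | yes z≡ιy = contradiction z≡ιy z≢ιy
      ... | no _    | no _    | no _     | no _     = refl

    -- The cases may overlap, but the equations for `swap` above hold in each of them. Matching on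
    -- the view gives access to these equations without repeating the four tests.
    data View (x y : A) : A → Set where
      left    : View x y x
      right   : View x y y
      ι-left  : View x y (ι x)
      ι-right : View x y (ι y)
      other   : ∀ {z} → z ≢ x → z ≢ y → z ≢ ι x → z ≢ ι y → View x y z

    view : ∀ x y z → View x y z
    view x y z with z ≟ᴬ x | z ≟ᴬ y | z ≟ᴬ ι x | z ≟ᴬ ι y
    ... | yes refl | _        | _        | _        = left
    ... | no _     | yes refl | _        | _        = right
    ... | no _     | no _     | yes refl | _        = ι-left
    ... | no _     | no _     | no _     | yes refl = ι-right
    ... | no z≢x   | no z≢y   | no z≢ιx  | no z≢ιy  = other z≢x z≢y z≢ιx z≢ιy

    module _ {x y : A} (ιx≢x : ι x ≢ x) (ιy≢y : ι y ≢ y) where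

      swap-involutive : ∀ z → swap x y (swap x y z) ≡ z
      swap-involutive z with view x y z
      ... | left      = trans (cong (swap x y) swap-left) swap-right
      ... | right     = trans (cong (swap x y) swap-right) swap-left
      ... | ι-left    = trans (cong (swap x y) (swap-ι-left ιx≢x)) (swap-ι-right ιy≢y)
      ... | ι-right   = trans (cong (swap x y) (swap-ι-right ιy≢y)) (swap-ι-left ιx≢x)
      ... | other a b c d = trans (cong (swap x y) (swap-other a b c d)) (swap-other a b c d)

      swap-ι : ∀ z → swap x y (ι z) ≡ ι (swap x y z)
      swap-ι z with view x y z
      ... | left      = trans (swap-ι-left ιx≢x) (cong ι (sym swap-left))
      ... | right     = trans (swap-ι-right ιy≢y) (cong ι (sym swap-right))
      ... | ι-left    = trans (cong (swap x y) (ι-involutive x))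
                          (trans swap-left (trans (sym (ι-involutive y)) (cong ι (sym (swap-ι-left ιx≢x)))))
      ... | ι-right   = trans (cong (swap x y) (ι-involutive y))
                          (trans swap-right (trans (sym (ι-involutive x)) (cong ι (sym (swap-ι-right ιy≢y)))))
      ... | other a b c d =
        trans (swap-other (λ e → c (trans (sym (ι-involutive z)) (cong ι e)))
                          (λ e → d (trans (sym (ι-involutive z)) (cong ι e)))
                          (a ∘ ι-injective) (b ∘ ι-injective))
              (cong ι (sym (swap-other a b c d)))

      swap-label : ℓ x ≡ ℓ y → ∀ z → ℓ (swap x y z) ≡ ℓ z
      swap-label e z with view x y z
      ... | left      = trans (cong ℓ swap-left) (sym e)
      ... | right     = trans (cong ℓ swap-right) e
      ... | ι-left    = trans (cong ℓ (swap-ι-left ιx≢x)) (sym (ℓ-ι e))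
      ... | ι-right   = trans (cong ℓ (swap-ι-right ιy≢y)) (ℓ-ι e)
      ... | other a b c d = cong ℓ (swap-other a b c d)

    -- The maps live on all of `A` and are the identity off `U`, rather than being bijections of a
    -- subtype. Passing between `U` and a smaller support then amounts to composing with a swap.
    record Perm (U : List A) : Set where
      field
        to          : A → A
        from        : A → A
        to∘from     : ∀ z → to (from z) ≡ z
        from∘to     : ∀ z → from (to z) ≡ z
        fixes       : ∀ {z} → z ∉ U → to z ≡ z
        label       : ∀ z → ℓ (to z) ≡ ℓ z
        equivariant : ∀ z → to (ι z) ≡ ι (to z)

      injective : ∀ {w z} → to w ≡ to z → w ≡ z
      injective {w} {z} e = trans (sym (from∘to w)) (trans (cong from e) (from∘to z))

    open Perm

    -- An image outside `U` would itself be fixed, so by injectivity it would be `z`, which lies in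
    -- `U`.
    preserves : ∀ {U} (π : Perm U) {z} → z ∈ U → to π z ∈ U
    preserves {U} π {z} z∈U with Any.any? (to π z ≟ᴬ_) U
    ... | yes πz∈U = πz∈U
    ... | no  πz∉U = contradiction (subst (_∈ U) (sym (injective π (fixes π πz∉U))) z∈U) πz∉U

    inverse : ∀ {U} → Perm U → Perm U
    inverse π = record
      { to          = from π
      ; from        = to π
      ; to∘from     = from∘to π
      ; from∘to     = to∘from π
      ; fixes       = λ {z} z∉U → injective π (trans (to∘from π z) (sym (fixes π z∉U)))
      ; label       = λ z → trans (sym (label π (from π z))) (cong ℓ (to∘from π z))
      ; equivariant = λ z → injective π (trans (to∘from π (ι z))
                        (trans (cong ι (sym (to∘from π z))) (sym (equivariant π (from π z)))))
      }

    PermSetoid : List A → Setoid 0ℓ 0ℓ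
    PermSetoid U = record
      { Carrier       = Perm U
      ; _≈_           = λ π ρ → ∀ z → to π z ≡ to ρ z
      ; isEquivalence = record
        { refl  = λ _ → refl
        ; sym   = λ e z → sym (e z)
        ; trans = λ e e′ z → trans (e z) (e′ z)
        }
      }

    record FreeSupport (U : List A) : Set where
      field
        unique : Unique U
        closed : ∀ {x} → x ∈ U → ι x ∈ U
        free   : ∀ {x} → x ∈ U → ι x ≢ x

    open FreeSupport

    Outside : A → Pred A 0ℓ
    Outside x z = z ≢ x × z ≢ ι x

    outside? : ∀ x → Decidable (Outside x)
    outside? x z = ¬? (z ≟ᴬ x) ×-dec ¬? (z ≟ᴬ ι x)

    _∖_ : List A → A → List A
    U ∖ x = filter (outside? x) U

    ∖-free : ∀ {U} → FreeSupport U → ∀ x → FreeSupport (U ∖ x)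
    ∖-free {U} fs x = record
      { unique = Unique.filter⁺ (outside? x) (unique fs)
      ; closed = λ {z} z∈ → let z∈U , z≢x , z≢ιx = ∈-filter⁻ (outside? x) {xs = U} z∈ in
          ∈-filter⁺ (outside? x) (closed fs z∈U)
            ((λ e → z≢ιx (trans (sym (ι-involutive z)) (cong ι e))) , (z≢x ∘ ι-injective))
      ; free   = λ z∈ → free fs (proj₁ (∈-filter⁻ (outside? x) {xs = U} z∈))
      }

    labelled : ℕ → List A → List A
    labelled j U = filter (λ z → ℓ z ≟ j) U

    labelled⁻ : ∀ j U {z} → z ∈ labelled j U → z ∈ U × ℓ z ≡ j
    labelled⁻ j U = ∈-filter⁻ (λ z → ℓ z ≟ j) {xs = U}

    labelled⁺ : ∀ {j U z} → z ∈ U → ℓ z ≡ j → z ∈ labelled j U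
    labelled⁺ {j} = ∈-filter⁺ (λ z → ℓ z ≟ j)

    labelled-unique : ∀ {j U} → Unique U → Unique (labelled j U)
    labelled-unique {j} = Unique.filter⁺ (λ z → ℓ z ≟ j)

    Movable : Pred A 0ℓ
    Movable x = ι x ≢ x

    movable? : Decidable Movable
    movable? x = ¬? (ι x ≟ᴬ x)

    movables : List A → List A
    movables = filter movable?

    movables⁻ : ∀ V {x} → x ∈ movables V → x ∈ V × Movable x
    movables⁻ V = ∈-filter⁻ movable? {xs = V}

    movables-free : ∀ {V} → Unique V → (∀ {x} → x ∈ V → ι x ∈ V) → FreeSupport (movables V)
    movables-free {V} u closed-V = record
      { unique = Unique.filter⁺ movable? u
      ; closed = λ x∈ → let x∈V , moved = movables⁻ V x∈ in
          ∈-filter⁺ movable? (closed-V x∈V) (moved ∘ ι-injective)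
      ; free   = λ x∈ → proj₂ (movables⁻ V x∈)
      }

    movables-preserves : ∀ {V} (π : Perm (movables V)) {x} → x ∈ V → to π x ∈ V
    movables-preserves {V} π {x} x∈ with ι x ≟ᴬ x
    ... | no moved = proj₁ (movables⁻ V (preserves π (∈-filter⁺ movable? x∈ moved)))
    ... | yes fix  = subst (_∈ V) (sym (fixes π (λ x∈ → proj₂ (movables⁻ V x∈) fix))) x∈

    -- Only self-mirror elements are dropped, and there is at most one of them. The second
    -- alternative exhibits it, so that its label can be recognized as a self-mirror one.
    length-labelled-movables : ∀ {V} → Unique V → (∀ {x y} → ι x ≡ x → ι y ≡ y → x ≡ y) → ∀ j →
      length (labelled j V) ≡ length (labelled j (movables V)) ⊎
      ((∃ λ c → ι c ≡ c × ℓ c ≡ j) × length (labelled j V) ≡ suc (length (labelled j (movables V))))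
    length-labelled-movables {V} u fixed-unique j with Any.any? (λ x → ι x ≟ᴬ x) (labelled j V)
    ... | no none = inj₁ (length-unique-set (labelled-unique u) (labelled-unique (Unique.filter⁺ movable? u)) fwd bwd)
      where
      fwd : ∀ {x} → x ∈ labelled j V → x ∈ labelled j (movables V)
      fwd x∈ = let x∈V , e = labelled⁻ j V x∈ in
        labelled⁺ (∈-filter⁺ movable? x∈V (λ fix → none (Any.map (λ { refl → fix }) x∈))) e
      bwd : ∀ {x} → x ∈ labelled j (movables V) → x ∈ labelled j V
      bwd x∈ = let x∈s , e = labelled⁻ j (movables V) x∈ in labelled⁺ (proj₁ (movables⁻ V x∈s)) e
    ... | yes some with find some
    ... | c , c∈ , fix = inj₂ ((c , fix , proj₂ (labelled⁻ j V c∈)) ,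
            length-unique-set (labelled-unique u)
              (All.tabulate (λ { x∈ refl → c∉ x∈ }) ∷ labelled-unique (Unique.filter⁺ movable? u)) fwd bwd)
      where
      c∉ : c ∉ labelled j (movables V)
      c∉ x∈ = proj₂ (movables⁻ V (proj₁ (labelled⁻ j (movables V) x∈))) fix
      fwd : ∀ {x} → x ∈ labelled j V → x ∈ c ∷ labelled j (movables V)
      fwd {x} x∈ with ι x ≟ᴬ x
      ... | yes fix′ = here (fixed-unique fix′ fix)
      ... | no moved = let x∈V , e = labelled⁻ j V x∈ in there (labelled⁺ (∈-filter⁺ movable? x∈V moved) e)
      bwd : ∀ {x} → x ∈ c ∷ labelled j (movables V) → x ∈ labelled j V
      bwd (here refl) = c∈
      bwd (there x∈)  = let x∈s , e = labelled⁻ j (movables V) x∈ in labelled⁺ (proj₁ (movables⁻ V x∈s)) e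

    -- Orbit-stabilizer: the orbit of x is its label class in U, and
    -- swap x y sends x to y.
    module _ {U} (fs : FreeSupport U) {x} (x∈U : x ∈ U) where

      private
        orbit = labelled (ℓ x) U

        ∈-∖ : ∀ {z} → z ∈ U → z ≢ x → z ≢ ι x → z ∈ U ∖ x
        ∈-∖ z∈U z≢x z≢ιx = ∈-filter⁺ (outside? x) z∈U (z≢x , z≢ιx)

        ∖⇒∈ : ∀ {z} → z ∈ U ∖ x → z ∈ U
        ∖⇒∈ z∈ = proj₁ (∈-filter⁻ (outside? x) {xs = U} z∈)

        ∈orbit : (π : Perm U) → to π x ∈ orbit
        ∈orbit π = labelled⁺ (preserves π x∈U) (label π x)

        swap-outside : ∀ {y z} → y ∈ U → z ∉ U → swap x y z ≡ z
        swap-outside y∈U z∉U = swap-other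
          (λ { refl → z∉U x∈U }) (λ { refl → z∉U y∈U })
          (λ { refl → z∉U (closed fs x∈U) }) (λ { refl → z∉U (closed fs y∈U) })

        extend : ∀ {y} → y ∈ orbit → Perm (U ∖ x) → Perm U
        extend {y} y∈ ρ = record
          { to          = swap x y ∘ to ρ
          ; from        = from ρ ∘ swap x y
          ; to∘from     = λ z → trans (cong (swap x y) (to∘from ρ _)) (swap-involutive ιx≢x ιy≢y z)
          ; from∘to     = λ z → trans (cong (from ρ) (swap-involutive ιx≢x ιy≢y _)) (from∘to ρ z)
          ; fixes       = λ z∉U → trans (cong (swap x y) (fixes ρ (z∉U ∘ ∖⇒∈))) (swap-outside y∈U z∉U)
          ; label       = λ z → trans (swap-label ιx≢x ιy≢y (sym ℓy≡ℓx) _) (label ρ z)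
          ; equivariant = λ z → trans (cong (swap x y) (equivariant ρ z)) (swap-ι ιx≢x ιy≢y _)
          }
          where
          y∈U = proj₁ (labelled⁻ (ℓ x) U y∈)
          ℓy≡ℓx = proj₂ (labelled⁻ (ℓ x) U y∈)
          ιx≢x = free fs x∈U
          ιy≢y = free fs y∈U

        -- The swap brings `y`, the image of `x`, back to `x`. By equivariance `ι x` goes to `ι y`,
        -- which the same swap brings back to `ι x`; so both leave the support.
        restrict : Perm U → Perm (U ∖ x)
        restrict π = record
          { to          = swap x y ∘ to π
          ; from        = from π ∘ swap x y
          ; to∘from     = λ z → trans (cong (swap x y) (to∘from π _)) (swap-involutive ιx≢x ιy≢y z)
          ; from∘to     = λ z → trans (cong (from π) (swap-involutive ιx≢x ιy≢y _)) (from∘to π z)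
          ; fixes       = λ {z} z∉ → fixes′ z z∉
          ; label       = λ z → trans (swap-label ιx≢x ιy≢y (sym (label π x)) _) (label π z)
          ; equivariant = λ z → trans (cong (swap x y) (equivariant π z)) (swap-ι ιx≢x ιy≢y _)
          }
          where
          y = to π x
          y∈U = preserves π x∈U
          ιx≢x = free fs x∈U
          ιy≢y = free fs y∈U
          fixes′ : ∀ z → z ∉ U ∖ x → swap x y (to π z) ≡ z
          fixes′ z z∉ with z ≟ᴬ x | z ≟ᴬ ι x
          ... | yes refl | _        = swap-right
          ... | no _     | yes refl = trans (cong (swap x y) (equivariant π x)) (swap-ι-right ιy≢y)
          ... | no z≢x   | no z≢ιx  = trans (cong (swap x y) (fixes π z∉U)) (swap-outside y∈U z∉U)
            where z∉U = λ z∈U → z∉ (∈-∖ z∈U z≢x z≢ιx)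

        x∉∖ : x ∉ U ∖ x
        x∉∖ x∈ = proj₁ (proj₂ (∈-filter⁻ (outside? x) {xs = U} x∈)) refl

      orbit-stabilizer : ∀ {n} → HasCardinality (PermSetoid (U ∖ x)) n →
                         HasCardinality (PermSetoid U) (length orbit * n)
      orbit-stabilizer {n} R = hasCardinality {S = PermSetoid U} enum code code-cong enum∘code code∘enum
        where
        module R = Inverse R
        decode : Fin (length orbit) × Fin n → Perm U
        decode (k , m) = extend (∈-lookup {xs = orbit} k) (R.to m)

        enum : Fin (length orbit * n) → Perm U
        enum = decode ∘ remQuot n

        code : Perm U → Fin (length orbit * n)
        code π = combine (index (∈orbit π)) (R.from (restrict π))

        code-cong : ∀ {π ρ} → (∀ z → to π z ≡ to ρ z) → code π ≡ code ρ
        code-cong {π} {ρ} e = cong₂ combine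
          (index-unique (labelled-unique (unique fs)) (∈orbit π) (∈orbit ρ) (e x))
          (R.from-cong (λ z → cong₂ (swap x) (e x) (e z)))

        enum∘code : ∀ π z → to (enum (code π)) z ≡ to π z
        enum∘code π z = begin
          to (enum (code π)) z
            ≡⟨ cong (λ p → to (decode p) z) (remQuot-combine (index (∈orbit π)) (R.from (restrict π))) ⟩
          swap x (lookup orbit (index (∈orbit π))) (to (R.to (R.from (restrict π))) z)
            ≡⟨ cong₂ (swap x) (sym (lookup-index (∈orbit π))) (R.strictlyInverseˡ (restrict π) z) ⟩
          swap x (to π x) (swap x (to π x) (to π z))
            ≡⟨ swap-involutive (free fs x∈U) (free fs (preserves π x∈U)) _ ⟩
          to π z ∎
          where open ≡-Reasoning

        code∘enum : ∀ i → code (enum i) ≡ i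
        code∘enum i = trans
          (cong₂ combine
            (trans (index-unique (labelled-unique (unique fs)) (∈orbit (enum i)) (∈-lookup {xs = orbit} k) πx≡y)
                   (index-∈-lookup orbit k))
            (trans (R.from-cong restricted) (R.strictlyInverseʳ m)))
          (combine-remQuot {length orbit} n i)
          where
          k = proj₁ (remQuot {length orbit} n i)
          m = proj₂ (remQuot {length orbit} n i)
          y = lookup orbit k
          y∈U = proj₁ (labelled⁻ (ℓ x) U (∈-lookup {xs = orbit} k))
          πx≡y : to (enum i) x ≡ y
          πx≡y = trans (cong (swap x y) (fixes (R.to m) x∉∖)) swap-left
          restricted : ∀ z → swap x (to (enum i) x) (to (enum i) z) ≡ to (R.to m) z
          restricted z = trans (cong (λ w → swap x w (to (enum i) z)) πx≡y)
                               (swap-involutive (free fs x∈U) (free fs y∈U) _)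

    trivial-perm : HasCardinality (PermSetoid []) 1
    trivial-perm = hasCardinality {S = PermSetoid []} {1}
      (λ _ → record
        { to = id ; from = id ; to∘from = λ _ → refl ; from∘to = λ _ → refl
        ; fixes = λ _ → refl ; label = λ _ → refl ; equivariant = λ _ → refl })
      (λ _ → zero) (λ _ → refl) (λ π z → sym (fixes π λ ())) (λ { zero → refl })

    -- The labels up to b represent the labels modulo ι; `Fixed` singles out those
    -- that ι maps to themselves.
    module Count
      (b : ℕ)
      {Fixed : Pred ℕ 0ℓ} (fixed? : Decidable Fixed)
      (fold     : ∀ x → ℓ x ≤ b ⊎ ℓ (ι x) ≤ b)
      (fixed    : ∀ {x} → ℓ x ≤ b → Fixed (ℓ x) → ℓ (ι x) ≡ ℓ x)
      (nonfixed : ∀ {x} → ℓ x ≤ b → ¬ Fixed (ℓ x) → b < ℓ (ι x))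
      where

      -- On a self-mirror class this is the order of the hyperoctahedral group on `c / 2` mirror
      -- pairs, the rounding discarding a central element. On any other class it is that of the
      -- symmetric group, whose action on the mirror image is forced.
      order : ℕ → ℕ → ℕ
      order j c with fixed? j
      ... | yes _ = 2 ^ (c / 2) * (c / 2) !
      ... | no _  = c !

      order-fixed : ∀ {j c} → Fixed j → order j c ≡ 2 ^ (c / 2) * (c / 2) !
      order-fixed {j} fx with fixed? j
      ... | yes _  = refl
      ... | no ¬fx = contradiction fx ¬fx

      order-nonfixed : ∀ {j c} → ¬ Fixed j → order j c ≡ c !
      order-nonfixed {j} ¬fx with fixed? j
      ... | yes fx = contradiction fx ¬fx
      ... | no _   = refl

      order-suc : ∀ {j c} → Fixed j → 2 ∣ c → order j (suc c) ≡ order j c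
      order-suc fx 2∣c = trans (order-fixed fx)
        (trans (cong (λ h → 2 ^ h * h !) ([1+n]/2≡n/2 2∣c)) (sym (order-fixed fx)))

      -- For a label that is not fixed the mirror image would have a label above `b`, but here the
      -- mirror image is the element itself.
      self-mirror-fixed : ∀ {c} → ι c ≡ c → ℓ c ≤ b → Fixed (ℓ c)
      self-mirror-fixed {c} fix ℓc≤b with fixed? (ℓ c)
      ... | yes fx = fx
      ... | no ¬fx = contradiction ℓc≤b (ℕ.<⇒≱ (subst (b <_) (cong ℓ fix) (nonfixed ℓc≤b ¬fx)))

      private
        -- Evenness is carried along with the cardinality, because the hyperoctahedral recursion
        -- needs exact halves.
        Claim : List A → Set
        Claim U = (∀ {j} → j ≤ b → Fixed j → 2 ∣ length (labelled j U)) ×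
                  HasCardinality (PermSetoid U) (∏[ 0 ⋯ b ] λ j → order j (length (labelled j U)))

        order-zero : ∀ j → order j 0 ≡ 1
        order-zero j with fixed? j
        ... | yes _ = refl
        ... | no _  = refl

        empty : Claim []
        empty = (λ _ _ → divides 0 refl) ,
                subst (HasCardinality (PermSetoid [])) (sym ones) trivial-perm
          where
          product-ones : ∀ n → product (applyUpTo (λ _ → 1) n) ≡ 1
          product-ones zero    = refl
          product-ones (suc n) = trans (ℕ.+-identityʳ _) (product-ones n)
          ones : ∏[ 0 ⋯ b ] (λ j → order j 0) ≡ 1
          ones = trans (∏-applyUpTo b (λ j → order j 0))
                   (trans (product-applyUpTo-cong (suc b) (λ {j} _ → order-zero j)) (product-ones (suc b)))

        module _ {U} (fs : FreeSupport U) {x} (x∈U : x ∈ U) (ℓx≤b : ℓ x ≤ b) where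

          private
            count : List A → ℕ → ℕ
            count V j = length (labelled j V)

            ∖-∈ : ∀ {z} → z ∈ U ∖ x → z ∈ U
            ∖-∈ z∈ = proj₁ (∈-filter⁻ (outside? x) {xs = U} z∈)

            split : ∀ {z} → z ∈ U → z ≡ x ⊎ z ≡ ι x ⊎ z ∈ U ∖ x
            split {z} z∈U with z ≟ᴬ x | z ≟ᴬ ι x
            ... | yes e  | _       = inj₁ e
            ... | no _   | yes e   = inj₂ (inj₁ e)
            ... | no z≢x | no z≢ιx = inj₂ (inj₂ (∈-filter⁺ (outside? x) z∈U (z≢x , z≢ιx)))

            ≢-∖ : ∀ {j z} → z ∈ labelled j (U ∖ x) → x ≢ z × ι x ≢ z
            ≢-∖ {j} z∈ =
              let z≢x , z≢ιx = proj₂ (∈-filter⁻ (outside? x) {xs = U} (proj₁ (labelled⁻ j (U ∖ x) z∈)))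
              in z≢x ∘ sym , z≢ιx ∘ sym

            u∖ : ∀ {j} → Unique (labelled j (U ∖ x))
            u∖ = labelled-unique (unique (∖-free fs x))

            shrink : ∀ {j z} → z ∈ labelled j (U ∖ x) → z ∈ labelled j U
            shrink {j} z∈ = let z∈′ , e = labelled⁻ j (U ∖ x) z∈ in labelled⁺ (∖-∈ z∈′) e

          count-other : ∀ {j} → j ≢ ℓ x → j ≢ ℓ (ι x) → count U j ≡ count (U ∖ x) j
          count-other {j} j≢ j≢ι = length-unique-set (labelled-unique (unique fs)) u∖ fwd shrink
            where
            fwd : ∀ {z} → z ∈ labelled j U → z ∈ labelled j (U ∖ x)
            fwd z∈ with labelled⁻ j U z∈
            ... | z∈U , refl with split z∈U
            ... | inj₁ refl        = contradiction refl j≢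
            ... | inj₂ (inj₁ refl) = contradiction refl j≢ι
            ... | inj₂ (inj₂ z∈′)  = labelled⁺ z∈′ refl

          count-nonfixed : ℓ (ι x) ≢ ℓ x → count U (ℓ x) ≡ suc (count (U ∖ x) (ℓ x))
          count-nonfixed ne = length-unique-set (labelled-unique (unique fs))
            (All.tabulate (proj₁ ∘ ≢-∖) ∷ u∖) fwd bwd
            where
            fwd : ∀ {z} → z ∈ labelled (ℓ x) U → z ∈ x ∷ labelled (ℓ x) (U ∖ x)
            fwd z∈ with labelled⁻ (ℓ x) U z∈
            ... | z∈U , e with split z∈U
            ... | inj₁ refl        = here refl
            ... | inj₂ (inj₁ refl) = contradiction e ne
            ... | inj₂ (inj₂ z∈′)  = there (labelled⁺ z∈′ e)
            bwd : ∀ {z} → z ∈ x ∷ labelled (ℓ x) (U ∖ x) → z ∈ labelled (ℓ x) U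
            bwd (here refl) = labelled⁺ x∈U refl
            bwd (there z∈)  = shrink z∈

          count-fixed : ℓ (ι x) ≡ ℓ x → count U (ℓ x) ≡ suc (suc (count (U ∖ x) (ℓ x)))
          count-fixed eq = length-unique-set (labelled-unique (unique fs))
            (((free fs x∈U ∘ sym) ∷ All.tabulate (proj₁ ∘ ≢-∖)) ∷ (All.tabulate (proj₂ ∘ ≢-∖) ∷ u∖)) fwd bwd
            where
            fwd : ∀ {z} → z ∈ labelled (ℓ x) U → z ∈ x ∷ ι x ∷ labelled (ℓ x) (U ∖ x)
            fwd z∈ with labelled⁻ (ℓ x) U z∈
            ... | z∈U , e with split z∈U
            ... | inj₁ refl        = here refl
            ... | inj₂ (inj₁ refl) = there (here refl)
            ... | inj₂ (inj₂ z∈′)  = there (there (labelled⁺ z∈′ e))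
            bwd : ∀ {z} → z ∈ x ∷ ι x ∷ labelled (ℓ x) (U ∖ x) → z ∈ labelled (ℓ x) U
            bwd (here refl)         = labelled⁺ x∈U refl
            bwd (there (here refl)) = labelled⁺ (closed fs x∈U) eq
            bwd (there (there z∈))  = shrink z∈

          -- Orbit-stabilizer contributes the size of the class of `x`, and only the factor of that
          -- label changes: the label of `ι x` is either the same or above `b`, outside the product.
          -- In the first case the class loses two elements, which is the hyperoctahedral recursion;
          -- in the second it loses one, which is the recursion of the factorial.
          step : Claim (U ∖ x) → Claim U
          step (even , card) = even′ ,
            subst (HasCardinality (PermSetoid U)) (sym eq) (orbit-stabilizer fs x∈U card)
            where
            others : ∀ {j} → j ≤ b → j ≢ ℓ x → count U j ≡ count (U ∖ x) j
            others {j} j≤b j≢ with fixed? (ℓ x)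
            ... | yes fx = count-other j≢ (λ e → j≢ (trans e (fixed ℓx≤b fx)))
            ... | no ¬fx = count-other j≢ (λ { refl → ℕ.<⇒≱ (nonfixed ℓx≤b ¬fx) j≤b })

            even′ : ∀ {j} → j ≤ b → Fixed j → 2 ∣ count U j
            even′ {j} j≤b fx with j ≟ ℓ x
            ... | no j≢ = subst (2 ∣_) (sym (others j≤b j≢)) (even j≤b fx)
            ... | yes refl with even j≤b fx
            ... | divides h e = divides (suc h) (trans (count-fixed (fixed ℓx≤b fx)) (cong (2 +_) e))

            at-x : order (ℓ x) (count U (ℓ x)) ≡ count U (ℓ x) * order (ℓ x) (count (U ∖ x) (ℓ x))
            at-x with fixed? (ℓ x)
            ... | yes fx rewrite count-fixed (fixed ℓx≤b fx) = hyperoctahedral-step (even ℓx≤b fx)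
            ... | no ¬fx rewrite count-nonfixed (λ e → ℕ.<⇒≱ (nonfixed ℓx≤b ¬fx) (ℕ.≤-trans (ℕ.≤-reflexive e) ℓx≤b)) = refl

            eq : ∏[ 0 ⋯ b ] (λ j → order j (count U j)) ≡
                 count U (ℓ x) * ∏[ 0 ⋯ b ] (λ j → order j (count (U ∖ x) j))
            eq = begin
              ∏[ 0 ⋯ b ] (λ j → order j (count U j))   ≡⟨ ∏-applyUpTo b (λ j → order j (count U j)) ⟩
              product (applyUpTo (λ j → order j (count U j)) (suc b))
                ≡⟨ product-applyUpTo-scale (count U (ℓ x)) (s≤s ℓx≤b) at-x
                     (λ {j} j<b j≢ → cong (order j) (others (ℕ.≤-pred j<b) j≢)) ⟩
              count U (ℓ x) * product (applyUpTo (λ j → order j (count (U ∖ x) j)) (suc b))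
                ≡⟨ cong (count U (ℓ x) *_) (∏-applyUpTo b (λ j → order j (count (U ∖ x) j))) ⟨
              count U (ℓ x) * ∏[ 0 ⋯ b ] (λ j → order j (count (U ∖ x) j)) ∎
              where open ≡-Reasoning

        shorter : ∀ {k x} U → length U ≤ suc k → x ∈ U → length (U ∖ x) ≤ k
        shorter {x = x} U len x∈ = ℕ.≤-pred (ℕ.≤-trans
          (filter-notAll (outside? x) U (Any.map (λ { refl (x≢x , _) → x≢x refl }) x∈)) len)

        -- The bound `k` on the length drives the recursion, since `U ∖ x` is obtained by filtering
        -- and is not a structural part of `U`.
        claim : ∀ k U → length U ≤ k → FreeSupport U → Claim U
        claim k       []        _   fs = empty
        claim (suc k) U@(x ∷ _) len fs with fold x
        ... | inj₁ ℓx≤b  = step fs (here refl) ℓx≤b (claim k (U ∖ x) (shorter U len (here refl)) (∖-free fs x))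
        -- The label of the head may have no factor in the product. Then that of its mirror image
        -- has one, and removing the mirror image removes the same pair.
        ... | inj₂ ℓιx≤b = step fs ιx∈ ℓιx≤b (claim k (U ∖ ι x) (shorter U len ιx∈) (∖-free fs (ι x)))
          where ιx∈ = closed fs (here refl)

      even-labelled : ∀ {U j} → FreeSupport U → j ≤ b → Fixed j → 2 ∣ length (labelled j U)
      even-labelled {U} fs = proj₁ (claim (length U) U ℕ.≤-refl fs)

      -- A class that loses its central element is self-mirror and its movable part has even size,
      -- so the lost element is exactly what the rounded half ignores.
      order-movables : ∀ {V j} → Unique V → (∀ {x} → x ∈ V → ι x ∈ V) →
                       (∀ {x y} → ι x ≡ x → ι y ≡ y → x ≡ y) → j ≤ b →
                       order j (length (labelled j (movables V))) ≡ order j (length (labelled j V))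
      order-movables {V} {j} u closed-V fixed-unique j≤b with length-labelled-movables u fixed-unique j
      ... | inj₁ e = cong (order j) (sym e)
      ... | inj₂ ((c , fix , refl) , e) = trans
        (sym (order-suc fx (even-labelled (movables-free u closed-V) j≤b fx))) (cong (order j) (sym e))
        where fx = self-mirror-fixed fix j≤b

      perm-cardinality : ∀ {U} → FreeSupport U →
        HasCardinality (PermSetoid U) (∏[ 0 ⋯ b ] λ j → order j (length (labelled j U)))
      perm-cardinality {U} fs = proj₂ (claim (length U) U ℕ.≤-refl fs)

-- Beta-sets

module _ where

  open import Data.Integer using (+_; -[1+_]; -_; _+_; _-_; _*_; _≤_; _<_; 0ℤ; 1ℤ; -1ℤ; ∣_∣; +≤+; +<+; -≤+; -≤-; -<+; positive; _%ℕ_; _/ℕ_)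
  open import Data.Integer.Divisibility.Signed using (_∣_; divides; _∣?_; ∣m∣n⇒∣m-n; ∣m∣n⇒∣m+n; ∣m⇒∣-m; ∣n⇒∣m*n)
  open import Data.Integer.Tactic.RingSolver using (solve-∀)
  open import Relation.Unary using (_∈_; _∉_)

  minimal : ∀ {P : Pred ℕ 0ℓ} → Decidable P → ∀ n → P n → ∃ λ m → P m × (∀ {i} → i ℕ.< m → ¬ P i)
  minimal P? n pn with P? 0
  ... | yes p0 = 0 , p0 , λ ()
  minimal P? zero    pn | no ¬p0 = contradiction pn ¬p0
  minimal {P} P? (suc n) pn | no ¬p0 with minimal (P? ∘ suc) n pn
  ... | m , pm , below = suc m , pm , below′
    where
    below′ : ∀ {i} → i ℕ.< suc m → ¬ P i
    below′ {zero}  _         = ¬p0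
    below′ {suc i} (s≤s i<m) = below i<m

  translate-≤ : ∀ d {x y x′ y′} → x ≤ y → x + d ≡ x′ → y + d ≡ y′ → x′ ≤ y′
  translate-≤ d x≤y refl refl = ℤ.+-monoˡ-≤ d x≤y

  translate-< : ∀ d {x y x′ y′} → x < y → x + d ≡ x′ → y + d ≡ y′ → x′ < y′
  translate-< d x<y refl refl = ℤ.+-monoˡ-< d x<y

  VanishesFrom : Partition → ℕ → Set
  VanishesFrom p N = ∀ {i} → N ℕ.≤ i → part p i ≡ 0

  module _ (p : Partition) where

    part-support : ∀ {N i c} → VanishesFrom p N → c ℕ.< part p i → i ℕ.< N
    part-support {N} {i} van c<p with N ℕ.≤? i
    ... | yes N≤i = contradiction (subst (_ ℕ.<_) (van N≤i) c<p) λ ()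
    ... | no  N≰i = ℕ.≰⇒> N≰i

    -- As the parts decrease, the rows longer than `c` form an initial segment, and its length is
    -- what `conjugate` counts.
    conjugate-threshold : ∀ {c n} → (∀ {i} → i ℕ.< n → c ℕ.< part p i) → part p n ℕ.≤ c →
                          conjugate p c ≡ n
    conjugate-threshold {c} {n} above below = trans
      (length-unique-set (Unique.filter⁺ P? (Unique.upTo⁺ N)) (Unique.upTo⁺ n) fwd bwd) (length-upTo n)
      where
      N = proj₁ (vanishes p)
      P? = λ i → c ℕ.<? part p i
      fwd : ∀ {i} → i ∈ˡ filter P? (upTo N) → i ∈ˡ upTo n
      fwd {i} i∈ = ∈-upTo⁺ (ℕ.≰⇒> λ n≤i →
        ℕ.<⇒≱ (proj₂ (∈-filter⁻ P? {xs = upTo N} i∈)) (ℕ.≤-trans (decreasing p n≤i) below))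
      bwd : ∀ {i} → i ∈ˡ upTo n → i ∈ˡ filter P? (upTo N)
      bwd i∈ = let c<p = above (∈-upTo⁻ i∈) in
        ∈-filter⁺ P? (∈-upTo⁺ (part-support (proj₂ (vanishes p)) c<p)) c<p

    private
      threshold : ∀ c → ∃ λ n → conjugate p c ≡ n × part p n ℕ.≤ c × (∀ {i} → i ℕ.< n → c ℕ.< part p i)
      threshold c with minimal (λ n → part p n ℕ.≤? c) (proj₁ (vanishes p))
                         (subst (ℕ._≤ c) (sym (proj₂ (vanishes p) ℕ.≤-refl)) z≤n)
      ... | n , below , above =
        n , conjugate-threshold (ℕ.≰⇒> ∘ above) below , below , ℕ.≰⇒> ∘ above

    <conjugate⇒<part : ∀ {i c} → i ℕ.< conjugate p c → c ℕ.< part p i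
    <conjugate⇒<part {i} {c} i< with threshold c
    ... | n , eq , below , above = above (subst (i ℕ.<_) eq i<)

    <part⇒<conjugate : ∀ {i c} → c ℕ.< part p i → i ℕ.< conjugate p c
    <part⇒<conjugate {i} {c} c< with threshold c
    ... | n , eq , below , above = subst (i ℕ.<_) (sym eq)
      (ℕ.≰⇒> λ n≤i → ℕ.<⇒≱ c< (ℕ.≤-trans (decreasing p n≤i) below))

    β-decreasing : ∀ {m n} → m ℕ.< n → β p n < β p m
    β-decreasing m<n = ℤ.+-mono-≤-< (+≤+ (decreasing p (ℕ.<⇒≤ m<n))) (ℤ.neg-mono-< (+<+ (s≤s m<n)))

    β-injective : ∀ {m n} → β p m ≡ β p n → m ≡ n
    β-injective {m} {n} eq with ℕ.<-cmp m n
    ... | tri< m<n _ _ = contradiction (sym eq) (ℤ.<⇒≢ (β-decreasing m<n))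
    ... | tri≈ _ m≡n _ = m≡n
    ... | tri> _ _ n<m = contradiction eq (ℤ.<⇒≢ (β-decreasing n<m))

    β-tail : ∀ {N} → VanishesFrom p N → ∀ {i} → N ℕ.≤ i → β p i ≡ -[1+ i ]
    β-tail van {i} N≤i = cong (λ v → + v - + suc i) (van N≤i)

    -- The values of γ are the gaps of the beta-set, and hook lengths are
    -- differences β p r - γ c.
    γ : ℕ → ℤ
    γ c = + c - + conjugate p c

    γ<β : ∀ {r c} → c ℕ.< part p r → γ c < β p r
    γ<β c< = ℤ.+-mono-<-≤ (+<+ c<) (ℤ.neg-mono-≤ (+≤+ (<part⇒<conjugate c<)))

    β<γ : ∀ {r c} → part p r ℕ.≤ c → β p r < γ c
    β<γ {r} {c} ≤c = ℤ.+-mono-≤-< (+≤+ ≤c) (ℤ.neg-mono-< (+<+ (s≤s (ℕ.≮⇒≥ λ r< →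
      ℕ.<⇒≱ (<conjugate⇒<part r<) ≤c))))

    β≢γ : ∀ {r c} → β p r ≢ γ c
    β≢γ {r} {c} eq with c ℕ.<? part p r
    ... | yes c< = ℤ.<⇒≢ (γ<β c<) (sym eq)
    ... | no  c≮ = ℤ.<⇒≢ (β<γ (ℕ.≮⇒≥ c≮)) eq

    private
      β-bounded : ∀ x → ∃ λ n → β p n ≤ x
      β-bounded x = N ℕ.+ ∣ x ∣ , subst (_≤ x) (sym (β-tail (proj₂ (vanishes p)) (ℕ.m≤m+n N ∣ x ∣))) (low x)
        where
        N = proj₁ (vanishes p)
        low : ∀ x → -[1+ N ℕ.+ ∣ x ∣ ] ≤ x
        low (+ n)    = -≤+
        low -[1+ n ] = -≤- (ℕ.≤-trans (ℕ.n≤1+n n) (ℕ.m≤n+m (suc n) N))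

    -- Let `n` be the first index with `β p n ≤ x`. If equality fails, then `part p n ≤ x + n`,
    -- while all earlier parts exceed `x + n`. So column `x + n` has length `n`, and its gap is `x`.
    β-or-γ : ∀ x → x ∈ BetaSet p ⊎ ∃ λ c → x ≡ γ c
    β-or-γ x with minimal (λ n → β p n ℤ.≤? x) (proj₁ (β-bounded x)) (proj₂ (β-bounded x))
    ... | n , βn≤x , above with x ℤ.≟ β p n
    ... | yes x≡βn = inj₁ (n , x≡βn)
    ... | no  x≢βn = inj₂ (c , x≡γc)
      where
      part≤ : + part p n ≤ x + + n
      part≤ = translate-≤ (+ n) (ℤ.i<j⇒suc[i]≤j (ℤ.≤∧≢⇒< βn≤x (x≢βn ∘ sym))) (cancel (+ part p n) (+ n)) refl
        where
        cancel : ∀ a n → (1ℤ + (a - (1ℤ + n))) + n ≡ a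
        cancel = solve-∀
      c = ∣ x + + n ∣
      c≡ : + c ≡ x + + n
      c≡ = ℤ.0≤i⇒+∣i∣≡i (ℤ.≤-trans (+≤+ z≤n) part≤)
      above′ : ∀ {m} → (∀ {i} → i ℕ.< m → ¬ β p i ≤ x) → ∀ {i} → i ℕ.< m → x + + m < + part p i
      above′ {suc m} above (s≤s i≤m) = ℤ.<-≤-trans
        (translate-< (+ suc m) (ℤ.≰⇒> (above ℕ.≤-refl)) refl (cancel (+ part p m) (+ m)))
        (+≤+ (decreasing p i≤m))
        where
        cancel : ∀ a m → (a - (1ℤ + m)) + (1ℤ + m) ≡ a
        cancel = solve-∀
      conj≡ : conjugate p c ≡ n
      conj≡ = conjugate-threshold
        (λ i<n → ℤ.drop‿+<+ (subst (_< _) (sym c≡) (above′ above i<n)))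
        (ℤ.drop‿+≤+ (subst (_ ≤_) (sym c≡) part≤))
      x≡γc : x ≡ γ c
      x≡γc = sym (trans (cong₂ (λ c m → c - + m) c≡ conj≡) (cancel x (+ n)))
        where
        cancel : ∀ x n → x + n - n ≡ x
        cancel = solve-∀

    γ∉β : ∀ {c} → γ c ∉ BetaSet p
    γ∉β (r , eq) = β≢γ (sym eq)

    β? : Decidable (BetaSet p)
    β? x with β-or-γ x
    ... | inj₁ x∈      = yes x∈
    ... | inj₂ (c , refl) = no γ∉β

    hookLength≡β-γ : ∀ r c → hookLength p r c ≡ β p r - γ c
    hookLength≡β-γ r c = identity (+ part p r) (+ r) (+ conjugate p c) (+ c)
      where
      identity : ∀ a r b c → 1ℤ + (a - (1ℤ + r)) + (b - (1ℤ + c)) ≡ (a - (1ℤ + r)) - (c - b)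
      identity = solve-∀

    module _ {s} (core : IsCore s p) where

      -- If `β p r - s` were a gap `γ c`, then, being at most `β p r`, it would belong to a cell (r,
      -- c) of the diagram, whose hook length is the difference `s`.
      core-closed : ∀ {x} → x ∈ BetaSet p → x - + s ∈ BetaSet p
      core-closed {x} (r , refl) with β-or-γ (β p r - + s)
      ... | inj₁ ∈β = ∈β
      ... | inj₂ (c , eq) with c ℕ.<? part p r
      ... | yes c< = contradiction
        (trans (hookLength≡β-γ r c) (trans (cong (λ y → β p r - y) (sym eq)) (cancel (β p r) (+ s)))) (core r c c<)
        where
        cancel : ∀ x s → x - (x - s) ≡ s
        cancel = solve-∀
      ... | no c≮ = contradiction (subst (_≤ β p r) eq (ℤ.i-j≤i (β p r) (+ s)))
                                  (ℤ.<⇒≱ (β<γ (ℕ.≮⇒≥ c≮)))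

      core-closed* : ∀ k {x} → x ∈ BetaSet p → x - + k * + s ∈ BetaSet p
      core-closed* zero    {x} x∈ = subst (BetaSet p) (sym (identity x (+ s))) x∈
        where
        identity : ∀ x s → x - 0ℤ * s ≡ x
        identity = solve-∀
      core-closed* (suc k) {x} x∈ = subst (BetaSet p) (identity x (+ s) (+ k)) (core-closed (core-closed* k x∈))
        where
        identity : ∀ x s k → x - k * s - s ≡ x - (1ℤ + k) * s
        identity = solve-∀

    module _ (sc : SelfConjugate p) where

      -- In other words, for a self-conjugate partition the reflection x ↦ -1 - x exchanges beads
      -- and gaps.
      γ-selfConjugate : ∀ c → γ c ≡ -1ℤ - β p c
      γ-selfConjugate c = trans (cong (λ v → + c - + v) (sym (sc c))) (identity (+ c) (+ part p c))
        where
        identity : ∀ c v → c - v ≡ -1ℤ - (v - (1ℤ + c))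
        identity = solve-∀

      reflect-∈ : ∀ {x} → x ∈ BetaSet p → -1ℤ - x ∉ BetaSet p
      reflect-∈ (c , refl) = subst (_∉ BetaSet p) (γ-selfConjugate c) γ∉β

      reflect-∉ : ∀ {x} → x ∉ BetaSet p → -1ℤ - x ∈ BetaSet p
      reflect-∉ {x} x∉ with β-or-γ x
      ... | inj₁ x∈         = contradiction x∈ x∉
      ... | inj₂ (c , x≡γc) = c , trans (cong (λ y → -1ℤ - y) (trans x≡γc (γ-selfConjugate c))) (identity (β p c))
        where
        identity : ∀ x → -1ℤ - (-1ℤ - x) ≡ x
        identity = solve-∀

  -- Finite sums and congruences

  sumUpTo : (ℕ → ℤ) → ℕ → ℤ
  sumUpTo f n = foldr _+_ 0ℤ (applyUpTo f n)

  sumUpTo-suc : ∀ f n → sumUpTo f (suc n) ≡ sumUpTo f n + f n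
  sumUpTo-suc f zero    = ℤ.+-comm (f 0) 0ℤ
  sumUpTo-suc f (suc n) = trans (cong (λ y → f 0 + y) (sumUpTo-suc (f ∘ suc) n))
                                (sym (ℤ.+-assoc (f 0) (sumUpTo (f ∘ suc) n) (f (suc n))))

  -- Gauss's pairing of a sum with its reversal. There are two functions because the induction
  -- removes the first term of one and the last term of the other.
  sumUpTo-pair : ∀ f g c n → (∀ i j → suc (i ℕ.+ j) ≡ n → f i + g j ≡ c) →
                 sumUpTo f n + sumUpTo g n ≡ + n * c
  sumUpTo-pair f g c zero    _ = refl
  sumUpTo-pair f g c (suc n) h = begin
    (f 0 + sumUpTo (f ∘ suc) n) + sumUpTo g (suc n)
      ≡⟨ cong (λ y → (f 0 + sumUpTo (f ∘ suc) n) + y) (sumUpTo-suc g n) ⟩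
    (f 0 + sumUpTo (f ∘ suc) n) + (sumUpTo g n + g n)
      ≡⟨ rearrange (f 0) (sumUpTo (f ∘ suc) n) (sumUpTo g n) (g n) ⟩
    (f 0 + g n) + (sumUpTo (f ∘ suc) n + sumUpTo g n)
      ≡⟨ cong₂ _+_ (h 0 n refl) (sumUpTo-pair (f ∘ suc) g c n (λ i j e → h (suc i) j (cong suc e))) ⟩
    c + + n * c      ≡⟨ collect c (+ n) ⟩
    + suc n * c      ∎
    where
    open ≡-Reasoning
    rearrange : ∀ a b c d → (a + b) + (c + d) ≡ (a + d) + (b + c)
    rearrange = solve-∀
    collect : ∀ c n → c + n * c ≡ (1ℤ + n) * c
    collect = solve-∀

  2*nC2≡n*[n-1] : ∀ n → + 2 * + (n C 2) ≡ + n * (+ n - 1ℤ)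
  2*nC2≡n*[n-1] zero    = refl
  2*nC2≡n*[n-1] (suc n) = begin
    + 2 * + (suc n C 2)       ≡⟨ cong (λ m → + 2 * + m) (nCk+nC[k+1]≡[n+1]C[k+1] n 1) ⟨
    + 2 * + (n C 1 ℕ.+ n C 2) ≡⟨ cong (λ m → + 2 * + (m ℕ.+ n C 2)) (nC1≡n n) ⟩
    + 2 * (+ n + + (n C 2))   ≡⟨ ℤ.*-distribˡ-+ (+ 2) (+ n) (+ (n C 2)) ⟩
    + 2 * + n + + 2 * + (n C 2) ≡⟨ cong (λ y → + 2 * + n + y) (2*nC2≡n*[n-1] n) ⟩
    + 2 * + n + + n * (+ n - 1ℤ) ≡⟨ collect (+ n) ⟩
    + suc n * (+ suc n - 1ℤ)  ∎
    where
    open ≡-Reasoning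
    collect : ∀ n → + 2 * n + n * (n - 1ℤ) ≡ (1ℤ + n) * ((1ℤ + n) - 1ℤ)
    collect = solve-∀

  neg*pos<0 : ∀ k t .{{_ : NonZero t}} → -[1+ k ] * + t < 0ℤ
  neg*pos<0 k (suc t) = -<+

  residue-unique : ∀ {n i j} .{{_ : NonZero n}} → i ℕ.< n → j ℕ.< n → + n ∣ (+ i - + j) → i ≡ j
  residue-unique {n} {i} {j} i<n j<n (divides q eq) = unique q eq
    where
    open ≡-Reasoning
    mod : ∀ {i j k} → i ℕ.< n → j ℕ.< n → i ≡ j ℕ.+ k ℕ.* n → i ≡ j
    mod {i} {j} {k} i<n j<n eq = begin
      i                       ≡⟨ ℕ.m<n⇒m%n≡m i<n ⟨
      i ℕ.% n                 ≡⟨ cong (ℕ._% n) eq ⟩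
      (j ℕ.+ k ℕ.* n) ℕ.% n   ≡⟨ ℕ.[m+kn]%n≡m%n j k n ⟩
      j ℕ.% n                 ≡⟨ ℕ.m<n⇒m%n≡m j<n ⟩
      j                       ∎
    add : ∀ i j → i ≡ j + (i - j)
    add = solve-∀
    flip : ∀ i j q n → i - j ≡ (- q) * n → j ≡ i + q * n
    flip i j q n e = begin
      j                 ≡⟨ identity i j ⟩
      i - (i - j)       ≡⟨ cong (λ y → i - y) e ⟩
      i - (- q) * n     ≡⟨ neg i q n ⟩
      i + q * n         ∎
      where
      identity : ∀ i j → j ≡ i - (i - j)
      identity = solve-∀
      neg : ∀ i q n → i - (- q) * n ≡ i + q * n
      neg = solve-∀
    lift : ∀ {i j k} → + i ≡ + j + + k * + n → i ≡ j ℕ.+ k ℕ.* n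
    lift {i} {j} {k} e = ℤ.+-injective (trans e (cong (λ y → + j + y) (sym (ℤ.pos-* k n))))
    unique : ∀ q → + i - + j ≡ q * + n → i ≡ j
    unique (+ k)    e = mod {k = k} i<n j<n (lift {k = k} (trans (add (+ i) (+ j)) (cong (λ y → + j + y) e)))
    unique -[1+ k ] e = sym (mod {k = suc k} j<n i<n (lift {k = suc k} (flip (+ i) (+ j) (+ suc k) (+ n) e)))

  module _ {n : ℤ} where

    ≡mod-sym : ∀ x y → n ∣ (x - y) → n ∣ (y - x)
    ≡mod-sym x y d = subst (n ∣_) (identity x y) (∣m⇒∣-m d)
      where
      identity : ∀ x y → - (x - y) ≡ y - x
      identity = solve-∀

    ≡mod-trans : ∀ x y z → n ∣ (x - y) → n ∣ (y - z) → n ∣ (x - z)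
    ≡mod-trans x y z d e = subst (n ∣_) (identity x y z) (∣m∣n⇒∣m+n d e)
      where
      identity : ∀ x y z → (x - y) + (y - z) ≡ x - z
      identity = solve-∀

    ≡mod-reflect : ∀ c x y → n ∣ (x - y) → n ∣ ((c - x) - (c - y))
    ≡mod-reflect c x y d = subst (n ∣_) (identity c x y) (∣m⇒∣-m d)
      where
      identity : ∀ c x y → - (x - y) ≡ (c - x) - (c - y)
      identity = solve-∀

  -- Cores

  -- In a t-core every class modulo t meets the beta-set in an initial segment,
  -- so `a t p i` is the first element of the class of i missing from it.
  module _ {t} .{{_ : NonZero t}} {p} (core : IsCore t p) where

    a-congruent : ∀ i → + t ∣ (a t p i - i)
    a-congruent i with maximum-congruent t p i
    ... | divides q e = divides (1ℤ + q) (trans (split (+ t) (proj₁ (maximum t p i)) i)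
                          (trans (cong (λ y → + t + y) e) (collect q (+ t))))
      where
      split : ∀ t m i → (t + m) - i ≡ t + (m - i)
      split = solve-∀
      collect : ∀ q t → t + q * t ≡ (1ℤ + q) * t
      collect = solve-∀

    a-∈ : ∀ i → a t p i - + t ∈ BetaSet p
    a-∈ i = subst (BetaSet p) (identity (+ t) (proj₁ (maximum t p i)))
                  (proj₁ (proj₁ (proj₂ (maximum t p i))))
      where
      identity : ∀ t m → m ≡ (t + m) - t
      identity = solve-∀

    -- If `a t p i - x` is (k + 1)t, then `x` lies k steps of t below the bead `a t p i - t`, and a
    -- core is closed under such steps.
    below-a : ∀ {i x} → + t ∣ (x - i) → x < a t p i → x ∈ BetaSet p
    below-a {i} {x} d x<a with ≡mod-trans (a t p i) i x (a-congruent i) (≡mod-sym x i d)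
    ... | divides (+ suc k) e = subst (BetaSet p) eq (core-closed* p core k (a-∈ i))
      where
      identity : ∀ a x k t → a - x ≡ (1ℤ + k) * t → a - t - k * t ≡ x
      identity a x k t e = trans (lhs a x k t) (trans (cong (λ y → x + (y - (1ℤ + k) * t)) e) (rhs x k t))
        where
        lhs : ∀ a x k t → a - t - k * t ≡ x + ((a - x) - (1ℤ + k) * t)
        lhs = solve-∀
        rhs : ∀ x k t → x + ((1ℤ + k) * t - (1ℤ + k) * t) ≡ x
        rhs = solve-∀
      eq = identity (a t p i) x (+ k) (+ t) e
    ... | divides (+ zero) e = contradiction (sym (ℤ.i-j≡0⇒i≡j (a t p i) x e)) (ℤ.<⇒≢ x<a)
    ... | divides -[1+ k ] e = contradiction (ℤ.≤-<-trans (ℤ.i≤j⇒0≤j-i (ℤ.<⇒≤ x<a))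
        (subst (_< 0ℤ) (sym e) (neg*pos<0 k t))) (ℤ.<-irrefl {0ℤ} refl)

    above-a : ∀ {i x} → + t ∣ (x - i) → a t p i ≤ x → x ∉ BetaSet p
    above-a {i} {x} d a≤x x∈ = ℤ.<⇒≱ (ℤ.<-≤-trans (m<t+m t) a≤x)
                                     (proj₂ (proj₂ (maximum t p i)) (x∈ , d))
      where
      m<t+m : ∀ t .{{_ : NonZero t}} {m} → m < + t + m
      m<t+m (suc t) {m} = subst (_< + suc t + m) (ℤ.+-identityˡ m) (ℤ.+-monoˡ-< m (+<+ (s≤s z≤n)))

  -- The stabilizer as a group of permutations

  n∣i-i : ∀ {n} i → n ∣ (i - i)
  n∣i-i i = divides 0ℤ (ℤ.+-inverseʳ i)

  module SelfConjugateSCore {s} .{{_ : NonZero s}} p (pc : SelfConjugateCore s p) where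

    private
      core = proj₁ pc
      sc   = proj₂ pc

    -- The coordinate `a` with modulus `s` in place of `t`: in an s-core the first gap of a class
    -- modulo s is the element of the s-set in that class.
    rep : ℤ → ℤ
    rep = a s p

    rep-∈ : ∀ m → rep m ∈ SSet s p
    rep-∈ m = a-∈ core m , above-a core (a-congruent core m) ℤ.≤-refl

    -- Everything in the class below `rep m` is a bead, and `x` is not; conversely `x - s` is a
    -- bead, so it is at most the largest bead of the class, `rep m - s`.
    rep-unique : ∀ {x} m → x ∈ SSet s p → + s ∣ (x - m) → rep m ≡ x
    rep-unique {x} m (x-s∈ , x∉) d = ℤ.≤-antisym
      (ℤ.≮⇒≥ λ x<a → x∉ (below-a core d x<a))
      (translate-≤ (+ s) (proj₂ (proj₂ (maximum s p m)) (x-s∈ , d′)) (cancel x (+ s)) (ℤ.+-comm (proj₁ (maximum s p m)) (+ s)))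
      where
      cancel : ∀ x s → (x - s) + s ≡ x
      cancel = solve-∀
      identity : ∀ x m s → (x - m) - s ≡ (x - s) - m
      identity = solve-∀
      d′ : + s ∣ ((x - + s) - m)
      d′ = subst (+ s ∣_) (identity x m (+ s)) (∣m∣n⇒∣m-n d (divides 1ℤ (sym (ℤ.*-identityˡ (+ s)))))

    rep-cong : ∀ m n → + s ∣ (m - n) → rep m ≡ rep n
    rep-cong m n d = sym (rep-unique n (rep-∈ m) (≡mod-trans (rep m) m n (a-congruent core m) d))

    rep-fixed : ∀ {x} → x ∈ SSet s p → rep x ≡ x
    rep-fixed {x} x∈ = rep-unique x x∈ (n∣i-i x)

    mirror : ℤ → ℤ
    mirror x = + s - 1ℤ - x

    mirror-involutive : ∀ x → mirror (mirror x) ≡ x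
    mirror-involutive x = identity (+ s - 1ℤ) x
      where
      identity : ∀ c x → c - (c - x) ≡ x
      identity = solve-∀

    mirror-fixed-unique : ∀ {x y} → mirror x ≡ x → mirror y ≡ y → x ≡ y
    mirror-fixed-unique {x} {y} ex ey = ℤ.*-cancelˡ-≡ (+ 2) x y (trans (sym (twice x ex)) (twice y ey))
      where
      add : ∀ c x → c ≡ (c - x) + x
      add = solve-∀
      double : ∀ x → x + x ≡ + 2 * x
      double = solve-∀
      twice : ∀ x → mirror x ≡ x → + s - 1ℤ ≡ + 2 * x
      twice x e = trans (add (+ s - 1ℤ) x) (trans (cong (_+ x) e) (double x))

    -- The reflection of beads into gaps interchanges the two conditions that define the s-set:
    -- `mirror x - s` is the reflection of `x`, and `mirror x` that of `x - s`.
    mirror-∈ : ∀ {x} → x ∈ SSet s p → mirror x ∈ SSet s p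
    mirror-∈ {x} (x-s∈ , x∉) =
      subst (BetaSet p) (i₁ (+ s) x) (reflect-∉ p sc x∉) ,
      subst (_∉ BetaSet p) (i₂ (+ s) x) (reflect-∈ p sc x-s∈)
      where
      i₁ : ∀ s x → -1ℤ - x ≡ (s - 1ℤ - x) - s
      i₁ = solve-∀
      i₂ : ∀ s x → -1ℤ - (x - s) ≡ s - 1ℤ - x
      i₂ = solve-∀

    rep-mirror : ∀ m → rep (-1ℤ - m) ≡ mirror (rep m)
    rep-mirror m = rep-unique (-1ℤ - m) (mirror-∈ (rep-∈ m)) (divides-mirror (a-congruent core m))
      where
      divides-mirror : + s ∣ (rep m - m) → + s ∣ (mirror (rep m) - (-1ℤ - m))
      divides-mirror (divides q e) = divides (1ℤ - q)
        (trans (lhs (+ s) (rep m) m) (trans (cong (λ y → + s - y) e) (rhs (+ s) q)))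
        where
        lhs : ∀ s r m → (s - 1ℤ - r) - (-1ℤ - m) ≡ s - (r - m)
        lhs = solve-∀
        rhs : ∀ s q → s - q * s ≡ (1ℤ - q) * s
        rhs = solve-∀

    reps : List ℤ
    reps = applyUpTo (rep ∘ +_) s

    reps⁻ : ∀ {x} → x ∈ˡ reps → x ∈ SSet s p
    reps⁻ x∈ with ∈-applyUpTo⁻ (rep ∘ +_) x∈
    ... | i , _ , refl = rep-∈ (+ i)

    reps⁺ : ∀ {x} → x ∈ SSet s p → x ∈ˡ reps
    reps⁺ {x} x∈ = subst (_∈ˡ reps) (rep-unique (+ r) x∈ (divides (x /ℕ s) eq))
                         (∈-applyUpTo⁺ (rep ∘ +_) (ℤ.n%ℕd<d x s))
      where
      r = x %ℕ s
      cancel : ∀ r y → (r + y) - r ≡ y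
      cancel = solve-∀
      eq : x - + r ≡ (x /ℕ s) * + s
      eq = trans (cong (_- + r) (ℤ.a≡a%ℕn+[a/ℕn]*n x s)) (cancel (+ r) ((x /ℕ s) * + s))

    reps-unique : Unique reps
    reps-unique = Unique.applyUpTo⁺₁ (rep ∘ +_) s λ {i} {j} i<j j<s eq →
      ℕ.<⇒≢ i<j (residue-unique (ℕ.<-trans i<j j<s) j<s
        (≡mod-trans (+ i) (rep (+ i)) (+ j) (≡mod-sym (rep (+ i)) (+ i) (a-congruent core (+ i)))
          (subst (λ y → + s ∣ (y - + j)) (sym eq) (a-congruent core (+ j)))))

    module StabilizerPermutations
      {t} (ℓ : ℤ → ℕ)
      (ℓ-sound    : ∀ x y → ℓ x ≡ ℓ y → + t ∣ (x - y))
      (ℓ-complete : ∀ x y → + t ∣ (x - y) → ℓ x ≡ ℓ y)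
      where

      mirror-label : ∀ {x y} → ℓ x ≡ ℓ y → ℓ (mirror x) ≡ ℓ (mirror y)
      mirror-label {x} {y} e = ℓ-complete _ _ (≡mod-reflect (+ s - 1ℤ) x y (ℓ-sound x y e))

      open LabelledInvolution ℤ._≟_ mirror mirror-involutive ℓ mirror-label public

      -- The centre (s - 1)/2 is left out if it is an element; a permutation commuting with the
      -- mirror fixes it anyway.
      support : List ℤ
      support = movables reps

      support⁻ : ∀ {x} → x ∈ˡ support → x ∈ SSet s p
      support⁻ x∈ = reps⁻ (proj₁ (movables⁻ reps x∈))

      reps-closed : ∀ {x} → x ∈ˡ reps → mirror x ∈ˡ reps
      reps-closed x∈ = reps⁺ (mirror-∈ (reps⁻ x∈))

      free-support : FreeSupport support
      free-support = movables-free reps-unique reps-closed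

      perm-∈ : (π : Perm support) → ∀ {x} → x ∈ SSet s p → Perm.to π x ∈ SSet s p
      perm-∈ π x∈ = reps⁻ (movables-preserves π (reps⁺ x∈))

      -- The only extension of `π` from the s-set that commutes with translation by s, as
      -- `m - rep m` is a multiple of s.
      periodize : Perm support → ℤ → ℤ
      periodize π m = Perm.to π (rep m) + (m - rep m)

      rep-periodize : ∀ π m → rep (periodize π m) ≡ Perm.to π (rep m)
      rep-periodize π m = rep-unique (periodize π m) (perm-∈ π (rep-∈ m))
        (subst (+ s ∣_) (identity (Perm.to π (rep m)) (rep m) m) (a-congruent core m))
        where
        identity : ∀ x r m → r - m ≡ x - (x + (m - r))
        identity = solve-∀

      periodize-fixed : ∀ π {x} → x ∈ SSet s p → periodize π x ≡ Perm.to π x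
      periodize-fixed π {x} x∈ = trans (cong (λ r → Perm.to π r + (x - r)) (rep-fixed x∈)) (identity (Perm.to π x) x)
        where
        identity : ∀ y x → y + (x - x) ≡ y
        identity = solve-∀

      periodize-inverse : ∀ π ρ → (∀ x → Perm.to π (Perm.to ρ x) ≡ x) → ∀ m → periodize π (periodize ρ m) ≡ m
      periodize-inverse π ρ πρ m = begin
        periodize π (periodize ρ m)
          ≡⟨ cong (λ r → Perm.to π r + (periodize ρ m - r)) (rep-periodize ρ m) ⟩
        Perm.to π (Perm.to ρ (rep m)) + (periodize ρ m - Perm.to ρ (rep m))
          ≡⟨ cong (_+ (periodize ρ m - Perm.to ρ (rep m))) (πρ (rep m)) ⟩
        rep m + (periodize ρ m - Perm.to ρ (rep m))  ≡⟨ identity (rep m) (Perm.to ρ (rep m)) m ⟩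
        m ∎
        where
        open ≡-Reasoning
        identity : ∀ r x m → r + (x + (m - r) - x) ≡ m
        identity = solve-∀

      module _ (π : Perm support) where

        private
          f = periodize π

        periodize-periodic : ∀ m → f (m + + s) ≡ f m + + s
        periodize-periodic m = trans
          (cong (λ r → Perm.to π r + (m + + s - r))
                (rep-cong (m + + s) m (divides 1ℤ (cancel m (+ s)))))
          (identity (Perm.to π (rep m)) m (+ s) (rep m))
          where
          cancel : ∀ m s → (m + s) - m ≡ 1ℤ * s
          cancel = solve-∀
          identity : ∀ x m s r → x + (m + s - r) ≡ x + (m - r) + s
          identity = solve-∀

        periodize-antisymmetric : ∀ m → f (-1ℤ - m) ≡ -1ℤ - f m
        periodize-antisymmetric m = begin
          f (-1ℤ - m)  ≡⟨ cong (λ r → Perm.to π r + (-1ℤ - m - r)) (rep-mirror m) ⟩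
          Perm.to π (mirror (rep m)) + (-1ℤ - m - mirror (rep m))
            ≡⟨ cong (_+ (-1ℤ - m - mirror (rep m))) (Perm.equivariant π (rep m)) ⟩
          mirror (Perm.to π (rep m)) + (-1ℤ - m - mirror (rep m))
            ≡⟨ identity (+ s) (Perm.to π (rep m)) m (rep m) ⟩
          -1ℤ - f m    ∎
          where
          open ≡-Reasoning
          identity : ∀ s x m r → (s - 1ℤ - x) + (-1ℤ - m - (s - 1ℤ - r)) ≡ -1ℤ - (x + (m - r))
          identity = solve-∀

        periodize-congruent : ∀ m → + t ∣ (f m - m)
        periodize-congruent m = subst (+ t ∣_) (identity (Perm.to π (rep m)) m (rep m))
          (ℓ-sound (Perm.to π (rep m)) (rep m) (Perm.label π (rep m)))
          where
          identity : ∀ x m r → x - r ≡ (x + (m - r)) - m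
          identity = solve-∀

        -- Antisymmetry and periodicity give f(i) + f(s - 1 - i) = s - 1, so twice the sum is s(s -
        -- 1).
        periodize-balanced : foldr _+_ 0ℤ (map (λ i → f (+ i)) (upTo s)) ≡ + (s C 2)
        periodize-balanced = trans (cong (foldr _+_ 0ℤ) (map-upTo (f ∘ +_) s))
          (ℤ.*-cancelˡ-≡ (+ 2) _ _ (begin
            + 2 * sumUpTo (f ∘ +_) s                       ≡⟨ double (sumUpTo (f ∘ +_) s) ⟩
            sumUpTo (f ∘ +_) s + sumUpTo (f ∘ +_) s         ≡⟨ sumUpTo-pair (f ∘ +_) (f ∘ +_) (+ s - 1ℤ) s pair ⟩
            + s * (+ s - 1ℤ)                               ≡⟨ 2*nC2≡n*[n-1] s ⟨
            + 2 * + (s C 2) ∎))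
          where
          open ≡-Reasoning
          double : ∀ x → + 2 * x ≡ x + x
          double = solve-∀
          pair : ∀ i j → suc (i ℕ.+ j) ≡ s → f (+ i) + f (+ j) ≡ + s - 1ℤ
          pair i j e = begin
            f (+ i) + f (+ j)    ≡⟨ cong (λ k → f (+ i) + f k) j≡ ⟩
            f (+ i) + f (-1ℤ - + i + + s)
              ≡⟨ cong (λ y → f (+ i) + y) (trans (periodize-periodic (-1ℤ - + i)) (cong (_+ + s) (periodize-antisymmetric (+ i)))) ⟩
            f (+ i) + (-1ℤ - f (+ i) + + s) ≡⟨ cancel (f (+ i)) (+ s) ⟩
            + s - 1ℤ ∎
            where
            solve-j : ∀ i j → j ≡ -1ℤ - i + (1ℤ + (i + j))
            solve-j = solve-∀
            j≡ : + j ≡ -1ℤ - + i + + s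
            j≡ = trans (solve-j (+ i) (+ j)) (cong (λ n → -1ℤ - + i + + n) e)
            cancel : ∀ y s → y + (-1ℤ - y + s) ≡ s - 1ℤ
            cancel = solve-∀

      fromPerm : Perm support → Setoid.Carrier (Stabilizer s t p)
      fromPerm π = record
        { permutation   = mk↔ₛ′ (periodize π) (periodize (inverse π))
                            (periodize-inverse π (inverse π) (Perm.to∘from π))
                            (periodize-inverse (inverse π) π (Perm.from∘to π))
        ; periodic      = periodize-periodic π
        ; balanced      = periodize-balanced π
        ; congruent     = periodize-congruent π
        ; antisymmetric = periodize-antisymmetric π
        } , pc , (λ {x} x∈ → Perm.from π x , perm-∈ (inverse π) x∈ ,
                    trans (periodize-fixed π (perm-∈ (inverse π) x∈)) (Perm.to∘from π x)) ,
                 λ { (x , x∈ , refl) → subst (SSet s p) (sym (periodize-fixed π x∈)) (perm-∈ π x∈) }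

      -- `rep x ≡ x` characterizes the elements x of the s-set.
      onSSet : (ℤ → ℤ) → ℤ → ℤ
      onSSet f x with rep x ℤ.≟ x
      ... | yes _ = f x
      ... | no _  = x

      onSSet-∈ : ∀ f {x} → x ∈ SSet s p → onSSet f x ≡ f x
      onSSet-∈ f {x} x∈ with rep x ℤ.≟ x
      ... | yes _  = refl
      ... | no r≢x = contradiction (rep-fixed x∈) r≢x

      onSSet-∉ : ∀ f {x} → x ∉ SSet s p → onSSet f x ≡ x
      onSSet-∉ f {x} x∉ with rep x ℤ.≟ x
      ... | yes r≡x = contradiction (subst (SSet s p) r≡x (rep-∈ x)) x∉
      ... | no _    = refl

      onSSet-unique : ∀ f {x y} → (x ∈ SSet s p → f x ≡ y) → (x ∉ SSet s p → x ≡ y) → onSSet f x ≡ y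
      onSSet-unique f {x} f≡ x≡ with rep x ℤ.≟ x
      ... | yes r≡x = f≡ (subst (SSet s p) r≡x (rep-∈ x))
      ... | no r≢x  = x≡ (r≢x ∘ rep-fixed)

      SSet? : Decidable (SSet s p)
      SSet? x with rep x ℤ.≟ x
      ... | yes r≡x = yes (subst (SSet s p) r≡x (rep-∈ x))
      ... | no r≢x  = no (r≢x ∘ rep-fixed)

      module _ (stab : Setoid.Carrier (Stabilizer s t p)) where

        private
          module f = H (proj₁ stab)
          module f↔ = Inverse f.permutation
          S≐fS = proj₂ (proj₂ stab)

        to-∈ : ∀ {x} → x ∈ SSet s p → f.apply x ∈ SSet s p
        to-∈ x∈ = proj₂ S≐fS (_ , x∈ , refl)

        from-∈ : ∀ {x} → x ∈ SSet s p → f↔.from x ∈ SSet s p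
        from-∈ x∈ with proj₁ S≐fS x∈
        ... | y , y∈ , refl = subst (SSet s p) (sym (f↔.strictlyInverseʳ y)) y∈

        -- The mirror is the reflection x ↦ -1 - x followed by translation by s, and f commutes with
        -- both.
        apply-mirror : ∀ x → f.apply (mirror x) ≡ mirror (f.apply x)
        apply-mirror x = begin
          f.apply (+ s - 1ℤ - x)     ≡⟨ cong f.apply (identity (+ s) x) ⟩
          f.apply (-1ℤ - x + + s)    ≡⟨ f.periodic (-1ℤ - x) ⟩
          f.apply (-1ℤ - x) + + s    ≡⟨ cong (_+ + s) (f.antisymmetric x) ⟩
          -1ℤ - f.apply x + + s      ≡⟨ identity (+ s) (f.apply x) ⟨
          + s - 1ℤ - f.apply x       ∎
          where
          open ≡-Reasoning
          identity : ∀ s x → s - 1ℤ - x ≡ -1ℤ - x + s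
          identity = solve-∀

        apply-periodic : ∀ n m → f.apply (m + + n * + s) ≡ f.apply m + + n * + s
        apply-periodic zero    m = trans (cong f.apply (vanish m (+ s))) (sym (vanish (f.apply m) (+ s)))
          where
          vanish : ∀ m s → m + 0ℤ * s ≡ m
          vanish = solve-∀
        apply-periodic (suc n) m = begin
          f.apply (m + + suc n * + s)      ≡⟨ cong f.apply (split m (+ n) (+ s)) ⟩
          f.apply (m + + n * + s + + s)    ≡⟨ f.periodic (m + + n * + s) ⟩
          f.apply (m + + n * + s) + + s    ≡⟨ cong (_+ + s) (apply-periodic n m) ⟩
          f.apply m + + n * + s + + s      ≡⟨ split (f.apply m) (+ n) (+ s) ⟨
          f.apply m + + suc n * + s        ∎
          where
          open ≡-Reasoning
          split : ∀ m n s → m + (1ℤ + n) * s ≡ m + n * s + s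
          split = solve-∀

        apply-periodicℤ : ∀ q m → f.apply (m + q * + s) ≡ f.apply m + q * + s
        apply-periodicℤ (+ n)        m = apply-periodic n m
        -- For negative `q` the nonnegative case is used at `m + q * + s`, from where translation by
        -- `- q` leads back to `m`.
        apply-periodicℤ q@(-[1+ n ]) m = begin
          f.apply (m + q * + s)                           ≡⟨ add-subtract (f.apply (m + q * + s)) (- q) (+ s) ⟩
          f.apply (m + q * + s) + (- q) * + s + q * + s
            ≡⟨ cong (_+ q * + s) (apply-periodic (suc n) (m + q * + s)) ⟨
          f.apply (m + q * + s + (- q) * + s) + q * + s
            ≡⟨ cong (λ x → f.apply x + q * + s) (add-subtract m q (+ s)) ⟨
          f.apply m + q * + s                             ∎
          where
          open ≡-Reasoning
          add-subtract : ∀ m q s → m ≡ m + q * s + (- q) * s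
          add-subtract = solve-∀

        toPerm : Perm support
        toPerm = record
          { to          = to
          ; from        = from
          ; to∘from     = inverse′ f.apply f↔.from from-∈ f↔.strictlyInverseˡ
          ; from∘to     = inverse′ f↔.from f.apply to-∈ f↔.strictlyInverseʳ
          ; fixes       = fixes
          ; label       = label
          ; equivariant = equivariant
          }
          where
          to = onSSet f.apply
          from = onSSet f↔.from
          inverse′ : ∀ g h → (∀ {x} → x ∈ SSet s p → h x ∈ SSet s p) → (∀ x → g (h x) ≡ x) →
                     ∀ x → onSSet g (onSSet h x) ≡ x
          inverse′ g h h∈ gh x with SSet? x
          ... | yes x∈ = trans (cong (onSSet g) (onSSet-∈ h x∈)) (trans (onSSet-∈ g (h∈ x∈)) (gh x))
          ... | no x∉  = trans (cong (onSSet g) (onSSet-∉ h x∉)) (onSSet-∉ g x∉)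
          fixes : ∀ {x} → ¬ x ∈ˡ support → to x ≡ x
          fixes {x} x∉ with SSet? x
          ... | no x∉S  = onSSet-∉ f.apply x∉S
          ... | yes x∈S with mirror x ℤ.≟ x
          ... | no moved = contradiction (∈-filter⁺ movable? (reps⁺ x∈S) moved) x∉
          -- The image of the centre is self-mirror as well, so it is the centre.
          ... | yes fix  = trans (onSSet-∈ f.apply x∈S)
                             (mirror-fixed-unique (trans (sym (apply-mirror x)) (cong f.apply fix)) fix)
          label : ∀ x → ℓ (to x) ≡ ℓ x
          label x with SSet? x
          ... | no x∉S  = cong ℓ (onSSet-∉ f.apply x∉S)
          ... | yes x∈S = trans (cong ℓ (onSSet-∈ f.apply x∈S)) (ℓ-complete (f.apply x) x (f.congruent x))
          equivariant : ∀ x → to (mirror x) ≡ mirror (to x)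
          equivariant x with SSet? x
          ... | yes x∈S = trans (onSSet-∈ f.apply (mirror-∈ x∈S))
                            (trans (apply-mirror x) (cong mirror (sym (onSSet-∈ f.apply x∈S))))
          ... | no x∉S  = trans (onSSet-∉ f.apply (λ mx∈ → x∉S (subst (SSet s p) (mirror-involutive x) (mirror-∈ mx∈))))
                            (cong mirror (sym (onSSet-∉ f.apply x∉S)))

        fromPerm∘toPerm : ∀ m → H.apply (proj₁ (fromPerm toPerm)) m ≡ f.apply m
        fromPerm∘toPerm m with a-congruent core m
        ... | divides q e = begin
          onSSet f.apply (rep m) + (m - rep m)  ≡⟨ cong (_+ (m - rep m)) (onSSet-∈ f.apply (rep-∈ m)) ⟩
          f.apply (rep m) + (m - rep m)         ≡⟨ cong (λ y → f.apply (rep m) + y) m-r≡ ⟩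
          f.apply (rep m) + (- q) * + s         ≡⟨ apply-periodicℤ (- q) (rep m) ⟨
          f.apply (rep m + (- q) * + s)         ≡⟨ cong (λ y → f.apply (rep m + y)) m-r≡ ⟨
          f.apply (rep m + (m - rep m))         ≡⟨ cong f.apply (cancel (rep m) m) ⟩
          f.apply m ∎
          where
          open ≡-Reasoning
          cancel : ∀ r m → r + (m - r) ≡ m
          cancel = solve-∀
          flip : ∀ r m → m - r ≡ - (r - m)
          flip = solve-∀
          m-r≡ : m - rep m ≡ (- q) * + s
          m-r≡ = trans (flip (rep m) m) (trans (cong -_ e) (ℤ.neg-distribˡ-* q (+ s)))

      toPerm∘fromPerm : ∀ π x → Perm.to (toPerm (fromPerm π)) x ≡ Perm.to π x
      toPerm∘fromPerm π x = onSSet-unique (periodize π) (periodize-fixed π) (λ x∉ → sym (Perm.fixes π (x∉ ∘ support⁻)))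

      toPerm-cong : ∀ f g → (∀ m → H.apply (proj₁ f) m ≡ H.apply (proj₁ g) m) →
                    ∀ x → Perm.to (toPerm f) x ≡ Perm.to (toPerm g) x
      toPerm-cong f g e x with SSet? x
      ... | yes x∈ = trans (onSSet-∈ (H.apply (proj₁ f)) x∈)
                       (trans (e x) (sym (onSSet-∈ (H.apply (proj₁ g)) x∈)))
      ... | no x∉  = trans (onSSet-∉ (H.apply (proj₁ f)) x∉) (sym (onSSet-∉ (H.apply (proj₁ g)) x∉))

      perm-inverse : Inverse (PermSetoid support) (Stabilizer s t p)
      perm-inverse = record
        { to        = fromPerm
        ; from      = toPerm
        ; to-cong   = λ e m → cong (_+ (m - rep m)) (e (rep m))
        ; from-cong = λ {f} {g} → toPerm-cong f g
        ; inverse   = (λ {f} {π} e m → trans (cong (_+ (m - rep m)) (e (rep m))) (fromPerm∘toPerm f m)) ,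
                      (λ {π} {f} e x → trans (toPerm-cong f (fromPerm π) e x) (toPerm∘fromPerm π x))
        }

      stabilizer-cardinality : ∀ {n} → HasCardinality (PermSetoid support) n →
                               HasCardinality (Stabilizer s t p) n
      stabilizer-cardinality card = Composition.inverse card perm-inverse

  -- Counting beads in the classes modulo t

  module _ {P : Pred ℤ 0ℓ} (P? : Decidable P) where

    count : (ℕ → ℤ) → ℕ → ℕ
    count f n = length (filter P? (applyUpTo f n))

    private
      one : ℤ → ℕ
      one x = length (filter P? (x ∷ []))

    one-cong : ∀ {x y} → (P x → P y) → (P y → P x) → one x ≡ one y
    one-cong {x} {y} f g with P? x | P? y
    ... | yes _  | yes _  = refl
    ... | yes px | no ¬py = contradiction (f px) ¬py
    ... | no ¬px | yes py = contradiction (g py) ¬px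
    ... | no _   | no _   = refl

    count-suc : ∀ f n → count f (suc n) ≡ one (f 0) ℕ.+ count (f ∘ suc) n
    count-suc f n = trans (cong length (filter-++ P? (f 0 ∷ []) (applyUpTo (f ∘ suc) n)))
                          (length-++ (filter P? (f 0 ∷ [])))

    count-+ : ∀ f m n → count f (m ℕ.+ n) ≡ count f m ℕ.+ count (λ i → f (m ℕ.+ i)) n
    count-+ f zero    n = refl
    count-+ f (suc m) n = begin
      count f (suc (m ℕ.+ n))                  ≡⟨ count-suc f (m ℕ.+ n) ⟩
      one (f 0) ℕ.+ count (f ∘ suc) (m ℕ.+ n)  ≡⟨ cong (one (f 0) ℕ.+_) (count-+ (f ∘ suc) m n) ⟩
      one (f 0) ℕ.+ (count (f ∘ suc) m ℕ.+ k)  ≡⟨ ℕ.+-assoc (one (f 0)) (count (f ∘ suc) m) k ⟨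
      one (f 0) ℕ.+ count (f ∘ suc) m ℕ.+ k    ≡⟨ cong (ℕ._+ k) (count-suc f m) ⟨
      count f (suc m) ℕ.+ k                    ∎
      where
      open ≡-Reasoning
      k = count (λ i → f (suc m ℕ.+ i)) n

    count-cong : ∀ {f g} n → (∀ {i} → i ℕ.< n → f i ≡ g i) → count f n ≡ count g n
    count-cong         zero    f≗g = refl
    count-cong {f} {g} (suc n) f≗g = begin
      count f (suc n)                    ≡⟨ count-suc f n ⟩
      one (f 0) ℕ.+ count (f ∘ suc) n    ≡⟨ cong₂ (λ x m → one x ℕ.+ m) (f≗g (s≤s z≤n)) (count-cong n (f≗g ∘ s≤s)) ⟩
      one (g 0) ℕ.+ count (g ∘ suc) n    ≡⟨ count-suc g n ⟨
      count g (suc n)                    ∎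
      where open ≡-Reasoning

    -- Here g arises from f by carrying the entry at position `r` to position `r + d` and moving the
    -- entries in between forward by one. The carried entry may change its value, but not whether P
    -- holds. The length exceeds `r + d`, so the window contains the whole cycle.
    count-cycle : ∀ {f g} r d m →
      (∀ {i} → i ℕ.< r → g i ≡ f i) →
      (∀ {i} → i ℕ.< d → g (r ℕ.+ i) ≡ f (r ℕ.+ suc i)) →
      (P (g (r ℕ.+ d)) → P (f (r ℕ.+ 0))) → (P (f (r ℕ.+ 0)) → P (g (r ℕ.+ d))) →
      (∀ {i} → r ℕ.+ d ℕ.< i → g i ≡ f i) →
      count g (r ℕ.+ (d ℕ.+ suc m)) ≡ count f (r ℕ.+ (d ℕ.+ suc m))
    count-cycle {f} {g} r d m before shifted to from after = begin
      count g (r ℕ.+ (d ℕ.+ suc m))                   ≡⟨ count-+ g r (d ℕ.+ suc m) ⟩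
      count g r ℕ.+ count g′ (d ℕ.+ suc m)            ≡⟨ cong₂ ℕ._+_ (count-cong r before) middle ⟩
      count f r ℕ.+ count f′ (d ℕ.+ suc m)            ≡⟨ count-+ f r (d ℕ.+ suc m) ⟨
      count f (r ℕ.+ (d ℕ.+ suc m))                   ∎
      where
      open ≡-Reasoning
      f′ g′ : ℕ → ℤ
      f′ i = f (r ℕ.+ i)
      g′ i = g (r ℕ.+ i)
      rest : ∀ {i} → g′ (d ℕ.+ suc i) ≡ f′ (suc (d ℕ.+ i))
      rest {i} = trans
        (after (ℕ.+-monoʳ-< r (ℕ.≤-trans (ℕ.≤-reflexive (ℕ.+-comm 1 d)) (ℕ.+-monoʳ-≤ d (s≤s z≤n)))))
        (cong f′ (ℕ.+-suc d i))
      middle : count g′ (d ℕ.+ suc m) ≡ count f′ (d ℕ.+ suc m)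
      middle = begin
        count g′ (d ℕ.+ suc m)                        ≡⟨ count-+ g′ d (suc m) ⟩
        count g′ d ℕ.+ count (λ i → g′ (d ℕ.+ i)) (suc m)
          ≡⟨ cong₂ ℕ._+_ (count-cong d shifted) (count-suc (λ i → g′ (d ℕ.+ i)) m) ⟩
        count (f′ ∘ suc) d ℕ.+ (one (g′ (d ℕ.+ 0)) ℕ.+ count (λ i → g′ (d ℕ.+ suc i)) m)
          ≡⟨ cong₂ (λ x y → count (f′ ∘ suc) d ℕ.+ (x ℕ.+ y))
               (trans (cong (one ∘ g′) (ℕ.+-identityʳ d)) (one-cong to from)) (count-cong m (λ _ → rest)) ⟩
        count (f′ ∘ suc) d ℕ.+ (one (f′ 0) ℕ.+ count (λ i → f′ (suc (d ℕ.+ i))) m)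
          ≡⟨ exchange (count (f′ ∘ suc) d) (one (f′ 0)) _ ⟩
        one (f′ 0) ℕ.+ (count (f′ ∘ suc) d ℕ.+ count (λ i → f′ (suc (d ℕ.+ i))) m)
          ≡⟨ cong (one (f′ 0) ℕ.+_) (count-+ (f′ ∘ suc) d m) ⟨
        one (f′ 0) ℕ.+ count (f′ ∘ suc) (d ℕ.+ m)     ≡⟨ count-suc f′ (d ℕ.+ m) ⟨
        count f′ (suc (d ℕ.+ m))                      ≡⟨ cong (count f′) (ℕ.+-suc d m) ⟨
        count f′ (d ℕ.+ suc m)                        ∎
        where
        exchange : ∀ a b c → a ℕ.+ (b ℕ.+ c) ≡ b ℕ.+ (a ℕ.+ c)
        exchange a b c = trans (sym (ℕ.+-assoc a b c)) (trans (cong (ℕ._+ c) (ℕ.+-comm a b)) (ℕ.+-assoc b a c))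

  -- Hook removal is described by cells; this turns statements about the cells of a row into
  -- equations between parts.
  <-ext : ∀ {m n} → (∀ {j} → j ℕ.< m → j ℕ.< n) → (∀ {j} → j ℕ.< n → j ℕ.< m) → m ≡ n
  <-ext f g = ℕ.≤-antisym (ℕ.≮⇒≥ (ℕ.<-irrefl refl ∘ f)) (ℕ.≮⇒≥ (ℕ.<-irrefl refl ∘ g))

  class? : ∀ t c → Decidable (Class t c)
  class? t c x = + t ∣? (x - c)

  -- Removing the rim hook of (r, c) moves the bead β r to β r - t = γ c and
  -- permutes the indices of the beads in between cyclically.
  module _ {t} p q (removal : RemovesHook t p q) where

    private
      r = proj₁ removal
      c = proj₁ (proj₂ removal)
      rc∈ : Diagram p r c
      rc∈ = proj₁ (proj₂ (proj₂ removal))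
      hook≡t : hookLength p r c ≡ + t
      hook≡t = proj₁ (proj₂ (proj₂ (proj₂ removal)))
      fwd : ∀ {i j} → Diagram q i j → Diagram p i j × ¬ RimHook p r c i j
      fwd {i} {j} = Equivalence.to (proj₂ (proj₂ (proj₂ (proj₂ removal))) i j)
      bwd : ∀ {i j} → Diagram p i j × ¬ RimHook p r c i j → Diagram q i j
      bwd {i} {j} = Equivalence.from (proj₂ (proj₂ (proj₂ (proj₂ removal))) i j)

      -- The leg length: the rim hook occupies the rows from `r` to `r + d`.
      d = conjugate p c ℕ.∸ suc r
      conj≡ : conjugate p c ≡ suc (r ℕ.+ d)
      conj≡ = sym (ℕ.m+[n∸m]≡n (<part⇒<conjugate p rc∈))

      part-before : ∀ {i} → i ℕ.< r → part q i ≡ part p i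
      part-before i<r = <-ext (proj₁ ∘ fwd) (λ j< → bwd (j< , λ (_ , r≤i , _) → ℕ.<⇒≱ i<r r≤i))

      part-after : ∀ {i} → r ℕ.+ d ℕ.< i → part q i ≡ part p i
      part-after {i} d<i = <-ext (proj₁ ∘ fwd) λ j< → bwd (j< , λ (_ , _ , c≤j , _) →
        ℕ.<⇒≱ d<i (ℕ.≤-pred (subst (suc i ℕ.≤_) conj≡ (<part⇒<conjugate p (ℕ.≤-<-trans c≤j j<)))))

      -- A cell (i, j) survives exactly if (i + 1, j + 1) is in the old diagram: for `j` at least
      -- `c` by definition of the rim, and for smaller `j` because row i + 1 still reaches column
      -- `c`. The new row i is thus the old row i + 1 moved one step diagonally.
      part-shifted : ∀ {i} → r ℕ.≤ i → suc i ℕ.< conjugate p c → suc (part q i) ≡ part p (suc i)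
      part-shifted {i} r≤i i< = <-ext above below
        where
        c<p : c ℕ.< part p (suc i)
        c<p = <conjugate⇒<part p i<
        above : ∀ {j} → j ℕ.< suc (part q i) → j ℕ.< part p (suc i)
        above {zero}  _        = ℕ.≤-<-trans z≤n c<p
        above {suc j} (s≤s j<) with suc j ℕ.<? part p (suc i)
        ... | yes sj< = sj<
        ... | no  sj≮ = contradiction
          (proj₁ (fwd j<) , r≤i , ℕ.≤-pred (ℕ.≤-trans c<p (ℕ.≮⇒≥ sj≮)) , sj≮) (proj₂ (fwd j<))
        below : ∀ {j} → j ℕ.< part p (suc i) → j ℕ.< suc (part q i)
        below {zero}  _  = s≤s z≤n
        below {suc j} j< = s≤s (bwd (ℕ.≤-trans (ℕ.≤-trans (ℕ.n≤1+n _) j<) (decreasing p (ℕ.n≤1+n i)) ,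
                                     λ (_ , _ , _ , sj≮) → sj≮ j<))

      -- The row below the last one ends before column `c`, so every cell of the last row from
      -- column `c` on is on the rim and is removed.
      part-last : part q (r ℕ.+ d) ≡ c
      part-last = <-ext
        (λ {j} j< → ℕ.≰⇒> λ c≤j → proj₂ (fwd j<) (proj₁ (fwd j<) , ℕ.m≤m+n r d , c≤j , λ sj< →
          ℕ.<-irrefl (sym conj≡) (<part⇒<conjugate p (ℕ.≤-<-trans (ℕ.≤-trans c≤j (ℕ.n≤1+n j)) sj<))))
        (λ {j} j<c → bwd
          (ℕ.<-trans j<c (<conjugate⇒<part p (subst (r ℕ.+ d ℕ.<_) (sym conj≡) (ℕ.n<1+n (r ℕ.+ d)))) ,
           λ (_ , _ , c≤j , _) → ℕ.<⇒≱ j<c c≤j))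

      β-before : ∀ {i} → part q i ≡ part p i → β q i ≡ β p i
      β-before {i} e = cong (λ v → + v - + suc i) e

      β-shifted : ∀ {i} → i ℕ.< d → β q (r ℕ.+ i) ≡ β p (r ℕ.+ suc i)
      β-shifted {i} i<d = begin
        + part q (r ℕ.+ i) - + suc (r ℕ.+ i)            ≡⟨ identity (+ part q (r ℕ.+ i)) (+ suc (r ℕ.+ i)) ⟩
        + suc (part q (r ℕ.+ i)) - + suc (suc (r ℕ.+ i))
          ≡⟨ cong (λ v → + v - + suc (suc (r ℕ.+ i)))
               (part-shifted (ℕ.m≤m+n r i) (subst (suc (r ℕ.+ i) ℕ.<_) (sym conj≡) (s≤s (ℕ.+-monoʳ-< r i<d)))) ⟩
        β p (suc (r ℕ.+ i))                             ≡⟨ cong (β p) (ℕ.+-suc r i) ⟨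
        β p (r ℕ.+ suc i)                               ∎
        where
        open ≡-Reasoning
        identity : ∀ a b → a - b ≡ (1ℤ + a) - (1ℤ + b)
        identity = solve-∀

      β-last : β p (r ℕ.+ 0) - + t ≡ β q (r ℕ.+ d)
      β-last = begin
        β p (r ℕ.+ 0) - + t            ≡⟨ cong₂ (λ i h → β p i - h) (ℕ.+-identityʳ r) (trans (sym hook≡t) (hookLength≡β-γ p r c)) ⟩
        β p r - (β p r - γ p c)        ≡⟨ cancel (β p r) (γ p c) ⟩
        + c - + conjugate p c          ≡⟨ cong₂ (λ a b → + a - + b) (sym part-last) conj≡ ⟩
        β q (r ℕ.+ d)                  ∎
        where
        open ≡-Reasoning
        cancel : ∀ a b → a - (a - b) ≡ b
        cancel = solve-∀

      t∣step : + t ∣ (β p (r ℕ.+ 0) - β q (r ℕ.+ d))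
      t∣step = divides 1ℤ (trans (cong (λ y → β p (r ℕ.+ 0) - y) (sym β-last)) (identity (β p (r ℕ.+ 0)) (+ t)))
        where
        identity : ∀ a t → a - (a - t) ≡ 1ℤ * t
        identity = solve-∀

    removal-vanishes : ∀ {N} → VanishesFrom p N → VanishesFrom q N
    removal-vanishes van {i} N≤i = ℕ.n≤0⇒n≡0 (ℕ.≤-trans (ℕ.≮⇒≥ (ℕ.<-irrefl refl ∘ proj₁ ∘ fwd {i}))
                                                       (ℕ.≤-reflexive (van N≤i)))

    -- Row `r + d` is nonempty, so the whole cycle has indices below `N`; the one bead that changes
    -- its value moves by t and stays in its class.
    removal-count : ∀ {N} → VanishesFrom p N → ∀ x →
                    count (class? t x) (β q) N ≡ count (class? t x) (β p) N
    removal-count {N} van x = subst (λ n → count (class? t x) (β q) n ≡ count (class? t x) (β p) n) N≡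
      (count-cycle (class? t x) r d m
        (β-before ∘ part-before) β-shifted
        (≡mod-trans (β p (r ℕ.+ 0)) (β q (r ℕ.+ d)) x t∣step)
        (≡mod-trans (β q (r ℕ.+ d)) (β p (r ℕ.+ 0)) x (≡mod-sym (β p (r ℕ.+ 0)) (β q (r ℕ.+ d)) t∣step))
        (β-before ∘ part-after))
      where
      last<N : suc (r ℕ.+ d) ℕ.≤ N
      last<N = part-support p van (<conjugate⇒<part p (subst (r ℕ.+ d ℕ.<_) (sym conj≡) (ℕ.n<1+n (r ℕ.+ d))))
      m = N ℕ.∸ suc (r ℕ.+ d)
      N≡ : r ℕ.+ (d ℕ.+ suc m) ≡ N
      N≡ = trans (trans (sym (ℕ.+-assoc r d (suc m))) (ℕ.+-suc (r ℕ.+ d) m)) (ℕ.m+[n∸m]≡n last<N)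

  module _ {t : ℕ} where

    removals-vanish : ∀ {p q N} → Star (RemovesHook t) p q → VanishesFrom p N → VanishesFrom q N
    removals-vanish             ε                  van = van
    removals-vanish {p} {q = q} (_◅_ {j = m} h hs) van =
      removals-vanish hs (λ {i} → removal-vanishes p m h van {i})

    removals-count : ∀ {p q N} → Star (RemovesHook t) p q → VanishesFrom p N → ∀ x →
                     count (class? t x) (β q) N ≡ count (class? t x) (β p) N
    removals-count     ε                  van x = refl
    removals-count {p} (_◅_ {j = m} h hs) van x = trans
      (removals-count hs (λ {i} → removal-vanishes p m h van {i}) x) (removal-count p m h van x)

  module _ (p : Partition) {N} (van : VanishesFrom p N) where

    β-∈-below : ∀ {x} → x < - + N → x ∈ BetaSet p
    β-∈-below {+ n}      x< = contradiction (ℤ.<-≤-trans x< (ℤ.neg-mono-≤ {0ℤ} {+ N} (+≤+ z≤n))) λ { (+<+ ()) }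
    β-∈-below { -[1+ n ]} x< = n , sym (β-tail p van (ℕ.≤-pred (ℤ.drop‿+<+ (ℤ.neg-cancel-< x<))))

    -- Together with its converse `β-≥⁻` this translates a window of indices below `N` into a window
    -- of values from `- + N` on.
    β-≥ : ∀ {i} → i ℕ.< N → - + N ≤ β p i
    β-≥ {i} i<N = ℤ.≤-trans (ℤ.neg-mono-≤ (+≤+ i<N))
      (subst (_≤ β p i) (ℤ.+-identityˡ (- + suc i)) (ℤ.+-monoˡ-≤ (- + suc i) {0ℤ} {+ part p i} (+≤+ z≤n)))

    β-≥⁻ : ∀ {i} → - + N ≤ β p i → i ℕ.< N
    β-≥⁻ {i} N≤ with i ℕ.<? N
    ... | yes i<N = i<N
    ... | no  i≮N = contradiction (subst (- + N ≤_) (β-tail p van (ℕ.≮⇒≥ i≮N)) N≤)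
                      (ℤ.<⇒≱ (ℤ.neg-mono-< (+<+ (s≤s (ℕ.≮⇒≥ i≮N)))))

    βs-unique : ∀ n → Unique (applyUpTo (β p) n)
    βs-unique n = Unique.applyUpTo⁺₁ (β p) n (λ i<j _ e → ℕ.<⇒≢ i<j (β-injective p e))

  -- The beads of a t-core in the class of c with index below N are
  -- -N, -N + t, ..., a t q c - t.
  core-count : ∀ {t} .{{_ : NonZero t}} q → IsCore t q → ∀ {N} → VanishesFrom q N → ∀ c → + t ∣ (- + N - c) →
               + count (class? t c) (β q) N * + t ≡ a t q c + + N
  core-count {t} q core {N} van c N≡c with ≡mod-trans (a t q c) c (- + N) (a-congruent core c) (≡mod-sym (- + N) c N≡c)
  -- A negative quotient would put the gap `a t q c` below `- + N`, where there are only beads.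
  ... | divides -[1+ k ] e = contradiction (β-∈-below q van a<-N) (above-a core (a-congruent core c) ℤ.≤-refl)
    where
    cancel : ∀ a n → (a - (- n)) - n ≡ a
    cancel = solve-∀
    a<-N : a t q c < - + N
    a<-N = translate-< (- + N) (subst (_< 0ℤ) (sym e) (neg*pos<0 k t)) (cancel (a t q c) (+ N)) (ℤ.+-identityˡ (- + N))
  ... | divides (+ d) e = trans (cong (λ n → + n * + t) count≡d) (trans (sym e) (identity (a t q c) (+ N)))
    where
    identity : ∀ a n → a - (- n) ≡ a + n
    identity = solve-∀

    bead : ℕ → ℤ
    bead k = - + N + + k * + t

    0<t : ∀ t .{{_ : NonZero t}} → 0ℤ < + t
    0<t (suc t) = +<+ (s≤s z≤n)

    bead-mono : ∀ {i j} → i ℕ.< j → bead i < bead j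
    bead-mono {i} {j} i<j = ℤ.+-monoʳ-< (- + N) (ℤ.*-monoʳ-<-pos (+ t) {{positive (0<t t)}} (+<+ i<j))

    a≡bead : a t q c ≡ bead d
    a≡bead = trans (split (a t q c) (+ N)) (cong (λ y → - + N + y) e)
      where
      split : ∀ a n → a ≡ - n + (a - (- n))
      split = solve-∀

    bead-class : ∀ k → + t ∣ (bead k - c)
    bead-class k = ≡mod-trans (bead k) (- + N) c (divides (+ k) (cancel (- + N) (+ k * + t))) N≡c
      where
      cancel : ∀ n y → (n + y) - n ≡ y
      cancel = solve-∀

    fwd : ∀ {x} → x ∈ˡ filter (class? t c) (applyUpTo (β q) N) → x ∈ˡ applyUpTo bead d
    fwd {x} x∈ with ∈-filter⁻ (class? t c) {xs = applyUpTo (β q) N} x∈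
    ... | x∈β , x≡c with ∈-applyUpTo⁻ (β q) x∈β
    ... | i , i<N , refl with ≡mod-trans (β q i) c (- + N) x≡c (≡mod-sym (- + N) c N≡c)
    ... | divides (+ k) eq = subst (_∈ˡ applyUpTo bead d) (sym x≡bead) (∈-applyUpTo⁺ bead (ℕ.≰⇒> λ d≤k →
        above-a core x≡c (subst₂ _≤_ (sym a≡bead) (sym x≡bead) (bead-mono-≤ {d} {k} d≤k)) (i , refl)))
      where
      split : ∀ a n → a ≡ - n + (a - (- n))
      split = solve-∀
      x≡bead : β q i ≡ bead k
      x≡bead = trans (split (β q i) (+ N)) (cong (λ y → - + N + y) eq)
      bead-mono-≤ : ∀ {i j} → i ℕ.≤ j → bead i ≤ bead j
      bead-mono-≤ i≤j = ℤ.+-monoʳ-≤ (- + N) (ℤ.*-monoʳ-≤-nonNeg (+ t) (+≤+ i≤j))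
    ... | divides -[1+ k ] eq = contradiction (ℤ.i≤j⇒0≤j-i (β-≥ q van i<N))
        (ℤ.<⇒≱ (subst (_< 0ℤ) (sym eq) (neg*pos<0 k t)))

    bead-∈ : ∀ k → bead k ∈ BetaSet q → bead k ∈ˡ filter (class? t c) (applyUpTo (β q) N)
    bead-∈ k (i , eq) = ∈-filter⁺ (class? t c)
      (subst (_∈ˡ applyUpTo (β q) N) (sym eq) (∈-applyUpTo⁺ (β q) (β-≥⁻ q van (subst (- + N ≤_) eq low))))
      (bead-class k)
      where
      low : - + N ≤ bead k
      low = subst (_≤ bead k) (ℤ.+-identityʳ (- + N)) (ℤ.+-monoʳ-≤ (- + N) (subst (0ℤ ≤_) (ℤ.pos-* k t) (+≤+ z≤n)))

    bwd : ∀ {x} → x ∈ˡ applyUpTo bead d → x ∈ˡ filter (class? t c) (applyUpTo (β q) N)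
    bwd x∈ with ∈-applyUpTo⁻ bead x∈
    ... | k , k<d , refl = bead-∈ k (below-a core (bead-class k) (subst (bead k <_) (sym a≡bead) (bead-mono k<d)))

    count≡d : count (class? t c) (β q) N ≡ d
    count≡d = trans
      (length-unique-set (Unique.filter⁺ (class? t c) (βs-unique q van N))
         (Unique.applyUpTo⁺₁ bead d (λ i<j _ e → ℤ.<⇒≢ (bead-mono i<j) e)) fwd bwd)
      (length-applyUpTo bead d)

  module _ {s} .{{_ : NonZero s}} p (pc : SelfConjugateCore s p) (t : ℕ) where

    open SelfConjugateSCore p pc

    -- The beads y - s ≥ -N - s correspond to the elements y ≥ -N of the disjoint
    -- union of the beta-set and the s-set.
    window-count : ∀ {N} → VanishesFrom p N → ∀ c →
      count (class? t (c - + s)) (β p) (N ℕ.+ s) ≡ count (class? t c) (β p) N ℕ.+ length (filter (class? t c) reps)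
    window-count {N} van c = begin
      length L                    ≡⟨ length-map (_+ + s) L ⟨
      length (map (_+ + s) L)     ≡⟨ length-unique-set (Unique.map⁺ +-injective (Unique.filter⁺ (class? t (c - + s)) (βs-unique p van (N ℕ.+ s))))
                                       (Unique.++⁺ (Unique.filter⁺ (class? t c) (βs-unique p van N))
                                                   (Unique.filter⁺ (class? t c) reps-unique) disjoint) fwd bwd ⟩
      length (M ++ R)             ≡⟨ length-++ M ⟩
      length M ℕ.+ length R       ∎
      where
      open ≡-Reasoning
      L = filter (class? t (c - + s)) (applyUpTo (β p) (N ℕ.+ s))
      M = filter (class? t c) (applyUpTo (β p) N)
      R = filter (class? t c) reps

      van′ : VanishesFrom p (N ℕ.+ s)
      van′ N+s≤i = van (ℕ.≤-trans (ℕ.m≤m+n N s) N+s≤i)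

      M⁻ : ∀ {x} → x ∈ˡ M → x ∈ BetaSet p × - + N ≤ x × + t ∣ (x - c)
      M⁻ x∈ with ∈-filter⁻ (class? t c) {xs = applyUpTo (β p) N} x∈
      ... | x∈β , d with ∈-applyUpTo⁻ (β p) x∈β
      ... | i , i<N , refl = (i , refl) , β-≥ p van i<N , d

      R⁻ : ∀ {x} → x ∈ˡ R → x ∈ SSet s p × + t ∣ (x - c)
      R⁻ x∈ = let x∈r , d = ∈-filter⁻ (class? t c) {xs = reps} x∈ in reps⁻ x∈r , d

      disjoint : ∀ {x} → ¬ (x ∈ˡ M × x ∈ˡ R)
      disjoint (x∈M , x∈R) = proj₂ (proj₁ (R⁻ x∈R)) (proj₁ (M⁻ x∈M))

      class-shift : ∀ x c → (x + + s) - c ≡ x - (c - + s)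
      class-shift x c = identity x c (+ s)
        where
        identity : ∀ x c s → (x + s) - c ≡ x - (c - s)
        identity = solve-∀

      +-cancel : ∀ x → (x + + s) - + s ≡ x
      +-cancel x = identity x (+ s)
        where
        identity : ∀ x s → (x + s) - s ≡ x
        identity = solve-∀

      +-injective : ∀ {x y} → x + + s ≡ y + + s → x ≡ y
      +-injective {x} {y} e = trans (sym (+-cancel x)) (trans (cong (_- + s) e) (+-cancel y))

      -+-cancel : ∀ x → (x - + s) + + s ≡ x
      -+-cancel x = identity x (+ s)
        where
        identity : ∀ x s → (x - s) + s ≡ x
        identity = solve-∀

      -N-s : - + (N ℕ.+ s) ≡ - + N - + s
      -N-s = ℤ.neg-distrib-+ (+ N) (+ s)

      fwd : ∀ {x} → x ∈ˡ map (_+ + s) L → x ∈ˡ M ++ R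
      fwd x∈ with ∈-map⁻ (_+ + s) x∈
      ... | y , y∈ , refl with ∈-filter⁻ (class? t (c - + s)) {xs = applyUpTo (β p) (N ℕ.+ s)} y∈
      ... | y∈β , d with ∈-applyUpTo⁻ (β p) y∈β
      -- A bead moved up by s either is a bead again or is a gap with a bead s below it, that is, an
      -- element of the s-set.
      ... | i , i<N+s , refl with β? p (β p i + + s)
      ... | yes (n , eq) = ∈-++⁺ˡ (∈-filter⁺ (class? t c)
              (subst (_∈ˡ applyUpTo (β p) N) (sym eq) (∈-applyUpTo⁺ (β p) (β-≥⁻ p van (subst (- + N ≤_) eq low)))) d′)
        where
        d′ = subst (+ t ∣_) (sym (class-shift (β p i) c)) d
        low : - + N ≤ β p i + + s
        low = translate-≤ (+ s) (β-≥ p van′ i<N+s) (trans (cong (_+ + s) -N-s) (-+-cancel (- + N))) refl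
      ... | no ∉β = ∈-++⁺ʳ M (∈-filter⁺ (class? t c)
              (reps⁺ (subst (BetaSet p) (sym (+-cancel (β p i))) (i , refl) , ∉β)) d′)
        where
        d′ = subst (+ t ∣_) (sym (class-shift (β p i) c)) d

      back : ∀ {x} → x - + s ∈ BetaSet p → - + N ≤ x → + t ∣ (x - c) → x ∈ˡ map (_+ + s) L
      back {x} (i , eq) N≤x d = subst (_∈ˡ map (_+ + s) L) (-+-cancel x) (∈-map⁺ (_+ + s)
        (∈-filter⁺ (class? t (c - + s))
          (subst (_∈ˡ applyUpTo (β p) (N ℕ.+ s)) (sym eq) (∈-applyUpTo⁺ (β p) (β-≥⁻ p van′
            (subst₂ _≤_ (sym -N-s) eq (ℤ.+-monoˡ-≤ (- + s) N≤x)))))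
          (subst (+ t ∣_) (trans (cong (_- c) (sym (-+-cancel x))) (class-shift (x - + s) c)) d)))

      bwd : ∀ {x} → x ∈ˡ M ++ R → x ∈ˡ map (_+ + s) L
      bwd x∈ with ∈-++⁻ M x∈
      ... | inj₁ x∈M = let x∈β , N≤x , d = M⁻ x∈M in back (core-closed p (proj₁ pc) x∈β) N≤x d
      -- An element of the s-set is a gap, so it cannot lie below `- + N`.
      ... | inj₂ x∈R = let (x-s∈ , x∉) , d = R⁻ x∈R in back x-s∈ (ℤ.≮⇒≥ (x∉ ∘ β-∈-below p van)) d

    -- By `window-count` the number is a difference of truncated bead counts of `p`. Both survive
    -- the hook removals and can be read off the core `q`, where `core-count` evaluates them; `N`
    -- cancels from the difference.
    class-count : .{{_ : NonZero t}} → ∀ {q} → IsCoreOf t p q → ∀ c →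
      + length (filter (class? t (+ c)) reps) * + t ≡ a t q (+ c - + s) - (a t q (+ c) - + s)
    class-count {q} (removals , core) c = begin
      + R * + t                        ≡⟨ ℤ.+-identityʳ (+ R * + t) ⟨
      + R * + t + 0ℤ                   ≡⟨ add-subtract (+ M) (+ R) (+ t) ⟩
      (+ M + + R) * + t - + M * + t    ≡⟨ cong (λ n → + n * + t - + M * + t) (sym window) ⟩
      + L * + t - + M * + t            ≡⟨ cong₂ _-_ L≡ M≡ ⟩
      (a t q c-s + + (N ℕ.+ s)) - (a t q (+ c) + + N)
        ≡⟨ collect (a t q c-s) (a t q (+ c)) (+ N) (+ s) ⟩
      a t q c-s - (a t q (+ c) - + s)  ∎
      where
      open ≡-Reasoning
      c-s = + c - + s
      N₀ = proj₁ (vanishes p)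
      -- N is an upper bound of N₀ that is congruent to -c modulo t.
      N = N₀ ℕ.* t ℕ.+ c ℕ.* (t ℕ.∸ 1)
      N₀≤N : N₀ ℕ.≤ N
      N₀≤N = ℕ.≤-trans (ℕ.m≤m*n N₀ t) (ℕ.m≤m+n (N₀ ℕ.* t) _)
      van : VanishesFrom p N
      van N≤i = proj₂ (vanishes p) (ℕ.≤-trans N₀≤N N≤i)
      van′ : VanishesFrom p (N ℕ.+ s)
      van′ N+s≤i = van (ℕ.≤-trans (ℕ.m≤m+n N s) N+s≤i)
      R = length (filter (class? t (+ c)) reps)
      M = count (class? t (+ c)) (β q) N
      L = count (class? t c-s) (β q) (N ℕ.+ s)
      window : L ≡ M ℕ.+ R
      window = trans (removals-count removals van′ c-s)
        (trans (window-count van (+ c)) (cong (ℕ._+ R) (sym (removals-count removals van (+ c)))))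
      N≡-c : + t ∣ (- + N - + c)
      N≡-c = divides (- (+ N₀ + + c)) (residue t)
        where
        identity : ∀ n c t → - (n * (1ℤ + t) + c * t) - c ≡ - (n + c) * (1ℤ + t)
        identity = solve-∀
        residue : ∀ t .{{_ : NonZero t}} → - + (N₀ ℕ.* t ℕ.+ c ℕ.* (t ℕ.∸ 1)) - + c ≡ - (+ N₀ + + c) * + t
        residue (suc t) = trans
          (cong₂ (λ x y → - (x + y) - + c) (ℤ.pos-* N₀ (suc t)) (ℤ.pos-* c t)) (identity (+ N₀) (+ c) (+ t))
      N+s≡-c : + t ∣ (- + (N ℕ.+ s) - c-s)
      N+s≡-c = subst (+ t ∣_) (identity (+ N) (+ c) (+ s)) N≡-c
        where
        identity : ∀ n c s → - n - c ≡ - (n + s) - (c - s)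
        identity = solve-∀
      M≡ : + M * + t ≡ a t q (+ c) + + N
      M≡ = core-count q core (λ {i} → removals-vanish removals van {i}) (+ c) N≡-c
      L≡ : + L * + t ≡ a t q c-s + + (N ℕ.+ s)
      L≡ = core-count q core (λ {i} → removals-vanish removals van′ {i}) c-s N+s≡-c
      add-subtract : ∀ m r t → r * t + 0ℤ ≡ (m + r) * t - m * t
      add-subtract = solve-∀
      collect : ∀ x y n s → (x + (n + s)) - (y + n) ≡ x - (y - s)
      collect = solve-∀

    -- The classes in the numerator of z are those of `C - s` and `C` for the natural number C = s(j
    -- + 1) + k. The value of `zℤ` turns out to be a cardinality, so taking its absolute value in
    -- `z` is harmless.
    z-count : .{{_ : NonZero t}} → ∀ {q} → IsCoreOf t p q → ∀ j →
      length (filter (class? t (+ s * (+ j + 1ℤ) + shift s t)) reps) ≡ z s t q j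
    z-count {q} core j = sym (cong ∣_∣ (ℤ.*-cancelʳ-≡ (zℤ s t q (+ j)) (+ R) (+ t) (begin
      zℤ s t q (+ j) * + t          ≡⟨ _∣_.equality (numerator-divisible s t q (+ j)) ⟨
      zNumerator s t q (+ j)        ≡⟨⟩
      a t q (+ s * + j + k) - (a t q c - + s)
        ≡⟨ cong (λ i → a t q i - (a t q c - + s)) (identity (+ s) (+ j) k) ⟩
      a t q (c - + s) - (a t q c - + s)
        ≡⟨ cong (λ c → a t q (c - + s) - (a t q c - + s)) c≡ ⟩
      a t q (+ C - + s) - (a t q (+ C) - + s)
        ≡⟨ class-count core C ⟨
      + length (filter (class? t (+ C)) reps) * + t
        ≡⟨ cong (λ c → + length (filter (class? t c) reps) * + t) c≡ ⟨
      + R * + t                     ∎)))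
      where
      open ≡-Reasoning
      k = shift s t
      c = + s * (+ j + 1ℤ) + k
      R = length (filter (class? t c) reps)
      C = s ℕ.* (j ℕ.+ 1) ℕ.+ ((suc s ℕ.* (t ℕ.∸ 1)) ℕ./ 2)
      c≡ : c ≡ + C
      c≡ = cong (_+ k) (sym (ℤ.pos-* s (j ℕ.+ 1)))
      identity : ∀ s j k → s * j + k ≡ (s * (j + 1ℤ) + k) - s
      identity = solve-∀

  -- Labels

  inverse-mod : ∀ {s t} → Coprime s t → ∃ λ s′ → + t ∣ (+ s * s′ - 1ℤ)
  inverse-mod {s} {t} coprime with coprime-Bézout coprime
  ... | Bézout.+- x y eq = + x , divides (+ y) (trans
          (cong (_- 1ℤ) (trans (ℤ.*-comm (+ s) (+ x)) (trans (sym (ℤ.pos-* x s)) (trans (cong +_ (sym eq)) (cong (λ n → 1ℤ + n) (ℤ.pos-* y t))))))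
          (cancel (+ y * + t)))
    where
    cancel : ∀ y → (1ℤ + y) - 1ℤ ≡ y
    cancel = solve-∀
  ... | Bézout.-+ x y eq = - + x , divides (- + y) (trans (identity (+ s) (+ x))
          (trans (cong -_ (trans (cong (λ n → 1ℤ + n) (sym (ℤ.pos-* x s))) (trans (cong +_ eq) (ℤ.pos-* y t))))
                 (ℤ.neg-distribˡ-* (+ y) (+ t))))
    where
    identity : ∀ s x → s * (- x) - 1ℤ ≡ - (1ℤ + x * s)
    identity = solve-∀

  2∣n⊎2∣1+n : ∀ n → 2 ℕ.∣ n ⊎ 2 ℕ.∣ suc n
  2∣n⊎2∣1+n zero    = inj₁ (ℕ.divides 0 refl)
  2∣n⊎2∣1+n (suc n) with 2∣n⊎2∣1+n n
  ... | inj₁ (ℕ.divides h e) = inj₂ (ℕ.divides (suc h) (cong (2 ℕ.+_) e))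
  ... | inj₂ 2∣1+n           = inj₁ 2∣1+n

  module Label {s t} .{{_ : NonZero t}} (coprime : Coprime s t) where

    private
      k  = shift s t
      s′ = proj₁ (inverse-mod coprime)
      t∣ss′-1 = proj₂ (inverse-mod coprime)

    2*shift : ∀ t .{{_ : NonZero t}} → Coprime s t → + 2 * shift s t ≡ (+ s + 1ℤ) * (+ t - 1ℤ)
    2*shift (suc t) coprime = begin
      + 2 * + ((suc s ℕ.* t) ℕ./ 2)    ≡⟨ ℤ.pos-* 2 ((suc s ℕ.* t) ℕ./ 2) ⟨
      + (2 ℕ.* ((suc s ℕ.* t) ℕ./ 2))  ≡⟨ cong +_ (ℕ.m*[n/m]≡n 2∣) ⟩
      + (suc s ℕ.* t)                  ≡⟨ ℤ.pos-* (suc s) t ⟩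
      + suc s * + t                    ≡⟨ identity (+ s) (+ t) ⟩
      (+ s + 1ℤ) * (+ suc t - 1ℤ)      ∎
      where
      open ≡-Reasoning
      identity : ∀ s t → (1ℤ + s) * t ≡ (s + 1ℤ) * ((1ℤ + t) - 1ℤ)
      identity = solve-∀
      2∣ : 2 ℕ.∣ suc s ℕ.* t
      2∣ with 2∣n⊎2∣1+n t | 2∣n⊎2∣1+n s
      ... | inj₁ 2∣t   | _          = ℕ.∣n⇒∣m*n (suc s) 2∣t
      ... | inj₂ _     | inj₂ 2∣1+s = ℕ.∣m⇒∣m*n t 2∣1+s
      ... | inj₂ 2∣1+t | inj₁ 2∣s   = contradiction (coprime (2∣s , 2∣1+t)) λ ()

    -- The class of `center j` is the one whose s-set elements z s t q j counts.
    center : ℕ → ℤ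
    center j = + s * (+ j + 1ℤ) + k

    private
      -- The solution j of x ≡ s(j + 1) + k modulo t, with `s′` an inverse of s.
      w : ℤ → ℤ
      w x = s′ * (x - k) - 1ℤ

    ℓ : ℤ → ℕ
    ℓ x = w x %ℕ t

    ℓ<t : ∀ x → ℓ x ℕ.< t
    ℓ<t x = ℤ.n%ℕd<d (w x) t

    ℓ-center : ∀ x → + t ∣ (x - center (ℓ x))
    ℓ-center x = subst (+ t ∣_)
      (identity x k (+ s) s′ (w x /ℕ t) (+ t) (w x) (+ ℓ x) refl (ℤ.a≡a%ℕn+[a/ℕn]*n (w x) t))
      (∣m∣n⇒∣m+n (∣m⇒∣-m (∣n⇒∣m*n (x - k) t∣ss′-1)) (divides (+ s * (w x /ℕ t)) refl))
      where
      identity : ∀ x k s s′ q t w l → w ≡ s′ * (x - k) - 1ℤ → w ≡ l + q * t →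
                 - ((x - k) * (s * s′ - 1ℤ)) + (s * q) * t ≡ x - (s * (l + 1ℤ) + k)
      identity x k s s′ q t w l e e′ = begin
        - ((x - k) * (s * s′ - 1ℤ)) + (s * q) * t            ≡⟨ lhs x k s s′ q t ⟩
        x - (s * ((s′ * (x - k) - 1ℤ) - q * t + 1ℤ) + k)     ≡⟨ cong (λ w → x - (s * (w - q * t + 1ℤ) + k)) (trans (sym e) e′) ⟩
        x - (s * ((l + q * t) - q * t + 1ℤ) + k)             ≡⟨ rhs x k s q t l ⟩
        x - (s * (l + 1ℤ) + k)                               ∎
        where
        open ≡-Reasoning
        lhs : ∀ x k s s′ q t → - ((x - k) * (s * s′ - 1ℤ)) + (s * q) * t ≡ x - (s * ((s′ * (x - k) - 1ℤ) - q * t + 1ℤ) + k)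
        lhs = solve-∀
        rhs : ∀ x k s q t l → x - (s * ((l + q * t) - q * t + 1ℤ) + k) ≡ x - (s * (l + 1ℤ) + k)
        rhs = solve-∀

    -- As s is invertible modulo t, congruent centers have congruent labels, and labels below t that
    -- are congruent are equal.
    ℓ-unique : ∀ {j} x → j ℕ.< t → + t ∣ (x - center j) → ℓ x ≡ j
    ℓ-unique {j} x j<t d = residue-unique (ℓ<t x) j<t
      (subst (+ t ∣_) (identity (+ s) s′ k (+ ℓ x) (+ j))
        (∣m∣n⇒∣m-n (∣n⇒∣m*n s′ (≡mod-trans (center (ℓ x)) x (center j) (≡mod-sym x (center (ℓ x)) (ℓ-center x)) d))
                   (∣n⇒∣m*n (+ ℓ x - + j) t∣ss′-1)))
      where
      identity : ∀ s s′ k i j → s′ * ((s * (i + 1ℤ) + k) - (s * (j + 1ℤ) + k)) - (i - j) * (s * s′ - 1ℤ) ≡ i - j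
      identity = solve-∀

    ℓ-sound : ∀ x y → ℓ x ≡ ℓ y → + t ∣ (x - y)
    ℓ-sound x y e = ≡mod-trans x (center (ℓ x)) y (ℓ-center x)
      (≡mod-sym y (center (ℓ x)) (subst (λ j → + t ∣ (y - center j)) (sym e) (ℓ-center y)))

    ℓ-complete : ∀ x y → + t ∣ (x - y) → ℓ x ≡ ℓ y
    ℓ-complete x y d = ℓ-unique x (ℓ<t y) (≡mod-trans x y (center (ℓ y)) d (ℓ-center y))

    -- By the choice of k, the centers of i and j add up to s(i + j) + (s - 1) + (s + 1)t, which is
    -- s - 1 modulo t as soon as t divides i + j.
    ℓ-mirror : ∀ x {j} → j ℕ.< t → t ℕ.∣ ℓ x ℕ.+ j → ℓ (+ s - 1ℤ - x) ≡ j
    ℓ-mirror x {j} j<t (ℕ.divides h e) = ℓ-unique (+ s - 1ℤ - x) j<t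
      (subst (+ t ∣_) (identity (+ s) (+ t) x k (+ ℓ x) (+ j) (2*shift t coprime))
        (∣m⇒∣-m (∣m∣n⇒∣m+n (ℓ-center x) (∣m∣n⇒∣m+n
          (∣n⇒∣m*n (+ s) (divides (+ h) (trans (cong +_ e) (ℤ.pos-* h t))))
          (divides (+ s + 1ℤ) refl)))))
      where
      identity : ∀ s t x k i j → + 2 * k ≡ (s + 1ℤ) * (t - 1ℤ) →
        - ((x - (s * (i + 1ℤ) + k)) + (s * (i + j) + (s + 1ℤ) * t)) ≡ (s - 1ℤ - x) - (s * (j + 1ℤ) + k)
      identity s t x k i j e = begin
        - ((x - (s * (i + 1ℤ) + k)) + (s * (i + j) + (s + 1ℤ) * t))   ≡⟨ lhs s t x k i j ⟩
        (s - 1ℤ - x) - (s * (j + 1ℤ) + ((s + 1ℤ) * (t - 1ℤ) - k))     ≡⟨ cong (λ y → (s - 1ℤ - x) - (s * (j + 1ℤ) + (y - k))) e ⟨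
        (s - 1ℤ - x) - (s * (j + 1ℤ) + (+ 2 * k - k))                 ≡⟨ rhs s x k j ⟩
        (s - 1ℤ - x) - (s * (j + 1ℤ) + k)                             ∎
        where
        open ≡-Reasoning
        lhs : ∀ s t x k i j → - ((x - (s * (i + 1ℤ) + k)) + (s * (i + j) + (s + 1ℤ) * t)) ≡ (s - 1ℤ - x) - (s * (j + 1ℤ) + ((s + 1ℤ) * (t - 1ℤ) - k))
        lhs = solve-∀
        rhs : ∀ s x k j → (s - 1ℤ - x) - (s * (j + 1ℤ) + (+ 2 * k - k)) ≡ (s - 1ℤ - x) - (s * (j + 1ℤ) + k)
        rhs = solve-∀

-- The order of the stabilizer

open import Data.List.Membership.Propositional using (_∈_)
open import Data.Nat using (_+_; _*_; _∸_; _^_; _/_; _!; _≤_; _<_; _≟_; _≤?_)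
open import Data.Nat.Divisibility using (_∣_; divides; _∣?_)
open import Data.Nat.Tactic.RingSolver using (solve-∀)

private
  ∏₁ : (ℕ → ℕ) → ℕ → ℕ
  ∏₁ f n = product (applyUpTo (λ i → f (1 + i)) n)

∏-first : ∀ n f → ∏[ 0 ⋯ n ] f ≡ f 0 * ∏[ 1 ⋯ n ] f
∏-first n f = trans (∏-applyUpTo n f) (cong (f 0 *_) (sym (cong product (map-upTo (λ i → f (1 + i)) n))))

product-applyUpTo-suc : ∀ f n → product (applyUpTo f (suc n)) ≡ product (applyUpTo f n) * f n
product-applyUpTo-suc f zero    = ℕ.*-comm (f 0) 1
product-applyUpTo-suc f (suc n) = trans (cong (f 0 *_) (product-applyUpTo-suc (f ∘ suc) n))
                                        (sym (ℕ.*-assoc (f 0) _ _))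

∏-last : ∀ n f → 1 ≤ n → ∏[ 1 ⋯ n ] f ≡ ∏[ 1 ⋯ n ∸ 1 ] f * f n
∏-last (suc n) f _ = begin
  ∏[ 1 ⋯ suc n ] f          ≡⟨ cong product (map-upTo (λ i → f (1 + i)) (suc n)) ⟩
  ∏₁ f (suc n)              ≡⟨ product-applyUpTo-suc (λ i → f (1 + i)) n ⟩
  ∏₁ f n * f (suc n)        ≡⟨ cong (λ l → product l * f (suc n)) (map-upTo (λ i → f (1 + i)) n) ⟨
  ∏[ 1 ⋯ n ] f * f (suc n)  ∎
  where open ≡-Reasoning

∏-cong : ∀ n {f g} → (∀ {i} → 1 ≤ i → i ≤ n → f i ≡ g i) → ∏[ 1 ⋯ n ] f ≡ ∏[ 1 ⋯ n ] g
∏-cong n {f} {g} f≗g = begin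
  ∏[ 1 ⋯ n ] f  ≡⟨ cong product (map-upTo (λ i → f (1 + i)) n) ⟩
  ∏₁ f n        ≡⟨ product-applyUpTo-cong n (f≗g (s≤s z≤n)) ⟩
  ∏₁ g n        ≡⟨ cong product (map-upTo (λ i → g (1 + i)) n) ⟨
  ∏[ 1 ⋯ n ] g  ∎
  where open ≡-Reasoning

m+m≡m*2 : ∀ m → m + m ≡ m * 2
m+m≡m*2 = solve-∀

n≤1+2*[n/2] : ∀ n → n ≤ 1 + (n / 2 + n / 2)
n≤1+2*[n/2] n = begin
  n                    ≡⟨ ℕ.m≡m%n+[m/n]*n n 2 ⟩
  n ℕ.% 2 + n / 2 * 2  ≤⟨ ℕ.+-mono-≤ (ℕ.≤-pred (ℕ.m%n<n n 2)) (ℕ.≤-reflexive (sym (m+m≡m*2 (n / 2)))) ⟩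
  1 + (n / 2 + n / 2)  ∎
  where open ℕ.≤-Reasoning

2*[n/2]≤n : ∀ n → n / 2 + n / 2 ≤ n
2*[n/2]≤n n = ℕ.≤-trans (ℕ.≤-reflexive (m+m≡m*2 (n / 2))) (ℕ.m/n*n≤m n 2)

n/2<n : ∀ n .{{_ : NonZero n}} → n / 2 < n
n/2<n n = ℕ.m/n<m n 2 (s≤s (s≤s z≤n))

-- Among the labels up to t/2, the solutions of 2j ≡ 0 modulo t.
Fixed : ℕ → Pred ℕ 0ℓ
Fixed t j = j ≡ 0 ⊎ (2 ∣ t × j ≡ t / 2)

fixed? : ∀ t → Decidable (Fixed t)
fixed? t j = (j ≟ 0) ⊎-dec ((2 ∣? t) ×-dec (j ≟ t / 2))

1≤n/2 : ∀ {n} .{{_ : NonZero n}} → 2 ∣ n → 1 ≤ n / 2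
1≤n/2 {n} 2∣n = ℕ.m≥n⇒m/n>0 (ℕ.∣⇒≤ 2∣n)

module StabilizerOrder {s t : ℕ} .{{_ : NonZero s}} .{{_ : NonZero t}} (coprime : Coprime s t)
                       p (pc : SelfConjugateCore s p) {q} (qc : IsCoreOf t p q) where

  open Label coprime
  open SelfConjugateSCore p pc
  open StabilizerPermutations {t} ℓ ℓ-sound ℓ-complete

  private
    b = t / 2

  ℓ-mirror-zero : ∀ {x} → ℓ x ≡ 0 → ℓ (mirror x) ≡ 0
  ℓ-mirror-zero {x} e = ℓ-mirror x (ℕ.≤-<-trans z≤n (ℓ<t x)) (subst (λ i → t ∣ i + 0) (sym e) (divides 0 refl))

  ℓ-mirror-nonzero : ∀ {x} → ℓ x ≢ 0 → ℓ (mirror x) ≡ t ∸ ℓ x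
  ℓ-mirror-nonzero {x} ne = ℓ-mirror x (ℕ.∸-monoʳ-< (ℕ.n≢0⇒n>0 ne) (ℕ.<⇒≤ (ℓ<t x)))
    (subst (t ∣_) (sym (ℕ.m+[n∸m]≡n (ℕ.<⇒≤ (ℓ<t x)))) ℕ.∣-refl)

  -- A label above `b` is mirrored to its difference from t, which is at most `b` because t ≤ 2b +
  -- 1.
  ℓ-fold : ∀ x → ℓ x ≤ b ⊎ ℓ (mirror x) ≤ b
  ℓ-fold x with ℓ x ≤? b
  ... | yes ℓ≤b = inj₁ ℓ≤b
  ... | no  ℓ≰b = inj₂ (subst (_≤ b) (sym (ℓ-mirror-nonzero (λ e → ℓ≰b (subst (_≤ b) (sym e) z≤n))))
    (ℕ.m≤n+o⇒m∸n≤o t (ℓ x) (ℕ.≤-trans (n≤1+2*[n/2] t) (ℕ.+-monoˡ-≤ b (ℕ.≰⇒> ℓ≰b)))))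

  ℓ-fixed : ∀ {x} → ℓ x ≤ b → Fixed t (ℓ x) → ℓ (mirror x) ≡ ℓ x
  ℓ-fixed     _ (inj₁ e) = trans (ℓ-mirror-zero e) (sym e)
  ℓ-fixed {x} _ (inj₂ (2∣t , e)) = ℓ-mirror x (ℓ<t x)
    (subst (t ∣_) (sym (trans (cong (λ i → i + i) e) (trans (m+m≡m*2 b) (ℕ.m/n*n≡m 2∣t)))) ℕ.∣-refl)

  -- If both `ℓ x` and `t ∸ ℓ x` were at most `b`, then t ≤ 2b; so t would be even and `ℓ x` equal
  -- to t/2, which is a fixed label.
  ℓ-nonfixed : ∀ {x} → ℓ x ≤ b → ¬ Fixed t (ℓ x) → b < ℓ (mirror x)
  ℓ-nonfixed {x} ℓ≤b ¬fx = subst (b <_) (sym (ℓ-mirror-nonzero (¬fx ∘ inj₁))) (ℕ.≰⇒> λ t∸ℓ≤b →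
    let t≤ℓ+b : t ≤ ℓ x + b
        t≤ℓ+b = ℕ.≤-trans (ℕ.m≤n+m∸n t (ℓ x)) (ℕ.+-monoʳ-≤ (ℓ x) t∸ℓ≤b)
        b≤ℓ   : b ≤ ℓ x
        b≤ℓ   = ℕ.+-cancelʳ-≤ b b (ℓ x) (ℕ.≤-trans (2*[n/2]≤n t) t≤ℓ+b)
        t≡b*2 : t ≡ b * 2
        t≡b*2 = trans (ℕ.≤-antisym (ℕ.≤-trans t≤ℓ+b (ℕ.+-monoˡ-≤ b ℓ≤b)) (2*[n/2]≤n t)) (m+m≡m*2 b)
    in ¬fx (inj₂ (divides b t≡b*2 , ℕ.≤-antisym ℓ≤b b≤ℓ)))

  open Count b (fixed? t) ℓ-fold ℓ-fixed ℓ-nonfixed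

  z-labelled : ∀ {j} → j ≤ b → length (labelled j reps) ≡ z s t q j
  z-labelled {j} j≤b = trans
    (cong length (filter-≐ (λ x → ℓ x ≟ j) (class? t (center j))
      ((λ { {x} refl → ℓ-center x }) , λ {x} → ℓ-unique x (ℕ.≤-<-trans j≤b (n/2<n t))) reps))
    (z-count p pc t qc j)

  private
    zᵢ = z s t q

  order-z : ∀ {j} → j ≤ b → order j (length (labelled j support)) ≡ order j (zᵢ j)
  order-z {j} j≤b = trans (order-movables reps-unique reps-closed mirror-fixed-unique j≤b)
                          (cong (order j) (z-labelled j≤b))

  stabilizer-order : HasCardinality (Stabilizer s t p) (order 0 (zᵢ 0) * ∏[ 1 ⋯ b ] λ j → order j (zᵢ j))
  stabilizer-order = subst (HasCardinality (Stabilizer s t p)) (begin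
    ∏[ 0 ⋯ b ] (λ j → order j (length (labelled j support)))
      ≡⟨ ∏-first b (λ j → order j (length (labelled j support))) ⟩
    order 0 (length (labelled 0 support)) * ∏[ 1 ⋯ b ] (λ j → order j (length (labelled j support)))
      ≡⟨ cong₂ _*_ (order-z z≤n) (∏-cong b (λ _ → order-z)) ⟩
    order 0 (zᵢ 0) * ∏[ 1 ⋯ b ] (λ j → order j (zᵢ j)) ∎)
    (stabilizer-cardinality (perm-cardinality free-support))
    where open ≡-Reasoning

  stabilizer-order-odd : ¬ 2 ∣ t → HasCardinality (Stabilizer s t p)
    (2 ^ (zᵢ 0 / 2) * (zᵢ 0 / 2) ! * ∏[ 1 ⋯ b ] (λ i → zᵢ i !))
  stabilizer-order-odd 2∤t = subst (HasCardinality (Stabilizer s t p))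
    (cong₂ _*_ (order-fixed {0} {zᵢ 0} (inj₁ refl)) (∏-cong b {λ j → order j (zᵢ j)} {λ i → zᵢ i !} nonfixed))
    stabilizer-order
    where
    nonfixed : ∀ {i} → 1 ≤ i → i ≤ b → order i (zᵢ i) ≡ zᵢ i !
    nonfixed {i} 1≤i _ = order-nonfixed {i} {zᵢ i} λ
      { (inj₁ refl)      → contradiction 1≤i λ ()
      ; (inj₂ (2∣t , _)) → 2∤t 2∣t }

  -- Here `b` is at least 1, so the fixed labels 0 and `b` are distinct and give two hyperoctahedral
  -- factors.
  stabilizer-order-even : 2 ∣ t → HasCardinality (Stabilizer s t p)
    (2 ^ (zᵢ 0 / 2) * (zᵢ 0 / 2) ! * (2 ^ (zᵢ b / 2) * (zᵢ b / 2) !) * ∏[ 1 ⋯ b ∸ 1 ] (λ i → zᵢ i !))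
  stabilizer-order-even 2∣t = subst (HasCardinality (Stabilizer s t p)) (begin
    order 0 (zᵢ 0) * ∏[ 1 ⋯ b ] (λ j → order j (zᵢ j))
      ≡⟨ cong (order 0 (zᵢ 0) *_) (∏-last b (λ j → order j (zᵢ j)) (1≤n/2 2∣t)) ⟩
    order 0 (zᵢ 0) * (∏[ 1 ⋯ b ∸ 1 ] (λ j → order j (zᵢ j)) * order b (zᵢ b))
      ≡⟨ cong₂ _*_ (order-fixed {0} {zᵢ 0} (inj₁ refl)) (cong₂ _*_ (∏-cong (b ∸ 1) {λ j → order j (zᵢ j)} {λ i → zᵢ i !} middle) (order-fixed {b} {zᵢ b} (inj₂ (2∣t , refl)))) ⟩
    A * (Q * B)   ≡⟨ rearrange A Q B ⟩
    A * B * Q     ∎)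
    stabilizer-order
    where
    open ≡-Reasoning
    A = 2 ^ (zᵢ 0 / 2) * (zᵢ 0 / 2) !
    B = 2 ^ (zᵢ b / 2) * (zᵢ b / 2) !
    Q = ∏[ 1 ⋯ b ∸ 1 ] (λ i → zᵢ i !)
    rearrange : ∀ a q b → a * (q * b) ≡ a * b * q
    rearrange = solve-∀
    middle : ∀ {i} → 1 ≤ i → i ≤ b ∸ 1 → order i (zᵢ i) ≡ zᵢ i !
    middle {i} 1≤i i≤ = order-nonfixed {i} {zᵢ i} λ
      { (inj₁ refl)       → contradiction 1≤i λ ()
      ; (inj₂ (_ , refl)) → ℕ.<⇒≱ (ℕ.∸-monoʳ-< (s≤s z≤n) 1≤i) i≤ }

-- The formula in the u-coordinates

module _ (s t : ℕ) .{{_ : NonZero t}} (q : Partition) where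

  private
    zᵢ = z s t q
    uᵢ = u s t q

  u-generic : ∀ {i} → 1 ≤ i → ¬ (2 ∣ t × i ≡ t / 2) → uᵢ i ≡ zᵢ i
  u-generic {suc i} _ ¬mid with 2 ∣? t | suc i ≟ t / 2
  ... | yes 2∣t | yes e = contradiction (2∣t , e) ¬mid
  ... | yes _   | no _  = refl
  ... | no _    | _     = refl

  u-middle : ∀ {i} → 1 ≤ i → 2 ∣ t → i ≡ t / 2 → uᵢ i ≡ zᵢ i / 2
  u-middle {suc i} _ 2∣t e with 2 ∣? t | suc i ≟ t / 2
  ... | yes _  | yes _ = refl
  ... | yes _  | no ne = contradiction e ne
  ... | no 2∤t | _     = contradiction 2∣t 2∤t

  u-product-odd : ¬ 2 ∣ t →
    2 ^ (zᵢ 0 / 2) * (zᵢ 0 / 2) ! * ∏[ 1 ⋯ t / 2 ] (λ i → zᵢ i !) ≡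
    2 ^ uᵢ 0 * ∏[ 0 ⋯ t / 2 ] (λ i → uᵢ i !)
  u-product-odd 2∤t = begin
    2 ^ u₀ * u₀ ! * ∏[ 1 ⋯ t / 2 ] (λ i → zᵢ i !)    ≡⟨ ℕ.*-assoc (2 ^ u₀) (u₀ !) _ ⟩
    2 ^ u₀ * (u₀ ! * ∏[ 1 ⋯ t / 2 ] (λ i → zᵢ i !))
      ≡⟨ cong (λ x → 2 ^ u₀ * (u₀ ! * x)) (∏-cong (t / 2) (λ 1≤i _ → cong _! (sym (u-generic 1≤i (2∤t ∘ proj₁))))) ⟩
    2 ^ u₀ * (u₀ ! * ∏[ 1 ⋯ t / 2 ] (λ i → uᵢ i !))  ≡⟨ cong (2 ^ u₀ *_) (∏-first (t / 2) (λ i → uᵢ i !)) ⟨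
    2 ^ u₀ * ∏[ 0 ⋯ t / 2 ] (λ i → uᵢ i !)           ∎
    where
    open ≡-Reasoning
    u₀ = zᵢ 0 / 2

  u-product-even : 2 ∣ t →
    2 ^ (zᵢ 0 / 2) * (zᵢ 0 / 2) ! * (2 ^ (zᵢ (t / 2) / 2) * (zᵢ (t / 2) / 2) !) * ∏[ 1 ⋯ t / 2 ∸ 1 ] (λ i → zᵢ i !) ≡
    2 ^ (uᵢ 0 + uᵢ (t / 2)) * ∏[ 0 ⋯ t / 2 ] (λ i → uᵢ i !)
  u-product-even 2∣t = begin
    2 ^ u₀ * u₀ ! * (2 ^ h * h !) * Q           ≡⟨ rearrange (2 ^ u₀) (u₀ !) (2 ^ h) (h !) Q ⟩
    2 ^ u₀ * 2 ^ h * (u₀ ! * (Q * h !))         ≡⟨ cong₂ _*_ (sym (ℕ.^-distribˡ-+-* 2 u₀ h)) (cong (λ x → u₀ ! * (x * h !)) Q≡) ⟩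
    2 ^ (u₀ + h) * (u₀ ! * (∏[ 1 ⋯ b ∸ 1 ] (λ i → uᵢ i !) * h !))
      ≡⟨ cong (λ h → 2 ^ (u₀ + h) * (u₀ ! * (∏[ 1 ⋯ b ∸ 1 ] (λ i → uᵢ i !) * h !))) (u-middle 1≤b 2∣t refl) ⟨
    2 ^ (u₀ + uᵢ b) * (u₀ ! * (∏[ 1 ⋯ b ∸ 1 ] (λ i → uᵢ i !) * uᵢ b !))
      ≡⟨ cong (λ x → 2 ^ (u₀ + uᵢ b) * (u₀ ! * x)) (∏-last b (λ i → uᵢ i !) 1≤b) ⟨
    2 ^ (u₀ + uᵢ b) * (u₀ ! * ∏[ 1 ⋯ b ] (λ i → uᵢ i !))
      ≡⟨ cong (2 ^ (u₀ + uᵢ b) *_) (∏-first b (λ i → uᵢ i !)) ⟨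
    2 ^ (u₀ + uᵢ b) * ∏[ 0 ⋯ b ] (λ i → uᵢ i !) ∎
    where
    open ≡-Reasoning
    b = t / 2
    u₀ = zᵢ 0 / 2
    h = zᵢ b / 2
    Q = ∏[ 1 ⋯ b ∸ 1 ] (λ i → zᵢ i !)
    1≤b = 1≤n/2 2∣t
    Q≡ : Q ≡ ∏[ 1 ⋯ b ∸ 1 ] (λ i → uᵢ i !)
    Q≡ = ∏-cong (b ∸ 1) λ 1≤i i≤ → cong _! (sym (u-generic 1≤i λ
      { (_ , refl) → ℕ.<⇒≱ (ℕ.∸-monoʳ-< (s≤s z≤n) 1≤i) i≤ }))
    rearrange : ∀ a b c d q → a * b * (c * d) * q ≡ a * c * (b * (q * d))
    rearrange = solve-∀

proposition6p12 : (s t : ℕ) .{{_ : NonZero s}} .{{_ : NonZero t}} → Coprime s t →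
    (p : Partition) → SelfConjugateCore s p →
    (q : Partition) → IsCoreOf t p q →
    let t′ = t / 2
        zᵢ = z s t q
        uᵢ = u s t q
    in
    (¬ (2 ∣ t) →
      let n = 2 ^ (zᵢ 0 / 2) * (zᵢ 0 / 2) ! * ∏[ 1 ⋯ t′ ] (λ i → zᵢ i !)
      in HasCardinality (Stabilizer s t p) n
         × n ≡ 2 ^ uᵢ 0 * ∏[ 0 ⋯ t′ ] (λ i → uᵢ i !))
    ×
    (2 ∣ t →
      let n = 2 ^ (zᵢ 0 / 2) * (zᵢ 0 / 2) ! * (2 ^ (zᵢ t′ / 2) * (zᵢ t′ / 2) !) * ∏[ 1 ⋯ t′ ∸ 1 ] (λ i → zᵢ i !)
      in HasCardinality (Stabilizer s t p) n
         × n ≡ 2 ^ (uᵢ 0 + uᵢ t′) * ∏[ 0 ⋯ t′ ] (λ i → uᵢ i !))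
proposition6p12 s t coprime p pc q qc =
  (λ odd  → stabilizer-order-odd odd , u-product-odd s t q odd) ,
  (λ even → stabilizer-order-even even , u-product-even s t q even)
  where open StabilizerOrder coprime p pc qc
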